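{- Let $n \ge 4$ be an even integer, let $m = \frac{n-2}{2}$, and let $G_n$ be the $n$-vertex graph obtained from two disjoint cliques $Q_1, Q_2$, each isomorphic to $K_m$, together with two non-adjacent vertices $u$ and $v$, each adjacent to every vertex of $Q_1 \cup Q_2$ (i.e., $G_n$ is the join of $2K_m$ with $2K_1$). Then $AT(G_n) = \frac{n}{2}$.
   Context: For a digraph $D$, an Eulerian subdigraph is a spanning subdigraph $F$ with $d^+_F(v) = d^-_F(v)$ for every vertex $v$; it is even or odd according to the parity of its number of edges. The Alon--Tarsi number $AT(G)$ is the minimum $k$ such that there is an orientation $D$ of $G$ in which every vertex has outdegree less than $k$ and the number of even Eulerian subdigraphs of $D$ differs from the number of odd Eulerian subdigraphs. -}

module Defs where

open import Data.Bool.Base using (Bool; true; false)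
open import Data.Empty using (⊥)
open import Data.Fin.Base using (Fin; splitAt)
open import Data.Fin.Properties using (all?) renaming (_≟_ to _≟ᶠ_)
open import Data.Fin.Subset using (Subset; ∣_∣; _∈_; _⊆_)
open import Data.Fin.Subset.Properties using (_⊆?_)
open import Data.List.Base using (List; []; _∷_; cartesianProductWith; filter; length)
open import Data.Nat.Base using (ℕ; zero; suc; _+_; _≤_; _<_; _∸_; _*_; _/_; parity)
open import Data.Nat.DivMod using (m*n/n≡m)
open import Data.Nat.Divisibility.Core using (_∣_; divides)
open import Data.Nat.Properties using (+-comm; +-identityʳ; *-comm) renaming (_≟_ to _≟ⁿ_)
open import Data.Parity.Base using (Parity; 0ℙ; 1ℙ)
open import Data.Parity.Properties using () renaming (_≟_ to _≟ᵖ_)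
open import Data.Product.Base using (_×_; ∃-syntax)
open import Data.Sum.Base using (_⊎_; inj₁; inj₂)
open import Data.Unit.Base using (⊤; tt)
open import Data.Vec.Base using (Vec; []; _∷_; lookup; map; sum)
open import Level using (0ℓ)
open import Relation.Binary.Core using (Rel)
open import Relation.Binary.Definitions using (Decidable; Irreflexive; Symmetric)
open import Relation.Binary.PropositionalEquality.Core using (_≡_; _≢_; refl; ≢-sym; trans; cong)
  renaming (sym to ≡-sym)
open import Relation.Nullary.Decidable.Core using (Dec; yes; no; _×-dec_; ¬?)
open import Relation.Nullary.Negation.Core using (¬_)

record Graph (n : ℕ) : Set₁ where
  infix 4 _~_ _~?_
  field
    _~_    : Rel (Fin n) 0ℓ
    _~?_   : Decidable _~_
    sym    : Symmetric _~_
    irrefl : Irreflexive _≡_ _~_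

K : ∀ m → Graph m
K m = record
  { _~_    = _≢_
  ; _~?_   = λ i j → ¬? (i ≟ᶠ j)
  ; sym    = ≢-sym
  ; irrefl = λ i≡j i≢j → i≢j i≡j
  }

-- Disjoint union and join differ only in whether a vertex of the first graph
-- is adjacent to a vertex of the second; `C` is that proposition.
module Combine {a b} (G : Graph a) (H : Graph b) (C : Set) (C? : Dec C) where
  private
    module G = Graph G
    module H = Graph H

  Adj : Rel (Fin a ⊎ Fin b) 0ℓ
  Adj (inj₁ i) (inj₁ j) = i G.~ j
  Adj (inj₁ _) (inj₂ _) = C
  Adj (inj₂ _) (inj₁ _) = C
  Adj (inj₂ i) (inj₂ j) = i H.~ j

  adj? : Decidable Adj
  adj? (inj₁ i) (inj₁ j) = i G.~? j
  adj? (inj₁ _) (inj₂ _) = C?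
  adj? (inj₂ _) (inj₁ _) = C?
  adj? (inj₂ i) (inj₂ j) = i H.~? j

  adj-sym : Symmetric Adj
  adj-sym {inj₁ _} {inj₁ _} p = G.sym p
  adj-sym {inj₁ _} {inj₂ _} p = p
  adj-sym {inj₂ _} {inj₁ _} p = p
  adj-sym {inj₂ _} {inj₂ _} p = H.sym p

  adj-irrefl : ∀ x → ¬ Adj x x
  adj-irrefl (inj₁ _) p = G.irrefl refl p
  adj-irrefl (inj₂ _) p = H.irrefl refl p

  graph : Graph (a + b)
  graph = record
    { _~_    = λ i j → Adj (splitAt a i) (splitAt a j)
    ; _~?_   = λ i j → adj? (splitAt a i) (splitAt a j)
    ; sym    = λ {i} {j} → adj-sym {splitAt a i} {splitAt a j}
    ; irrefl = λ { {i} refl → adj-irrefl (splitAt a i) }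
    }

infixr 6 _∪ᴳ_
infixr 5 _⋈_

_∪ᴳ_ : ∀ {a b} → Graph a → Graph b → Graph (a + b)
G ∪ᴳ H = Combine.graph G H ⊥ (no λ ())

_⋈_ : ∀ {a b} → Graph a → Graph b → Graph (a + b)
G ⋈ H = Combine.graph G H ⊤ (yes tt)

-- The join of two copies of `K m` with two isolated vertices has `n` vertices.
order-G : ∀ n → 4 ≤ n → 2 ∣ n → let m = (n ∸ 2) / 2 in (m + m) + (1 + 1) ≡ n
order-G .(suc r * 2) _ (divides (suc r) refl) rewrite m*n/n≡m r 2 ⦃ _ ⦄ =
  trans (+-comm (r + r) 2)
        (cong (2 +_) (trans (cong (r +_) (≡-sym (+-identityʳ r))) (*-comm 2 r)))

-- A digraph is its adjacency matrix: row `v` is the out-neighbourhood of `v`.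
-- Vectors rather than functions are used so that digraphs with the same arcs
-- are propositionally equal, and hence are counted once.
Digraph : ℕ → Set
Digraph n = Vec (Subset n) n

module _ {n : ℕ} where

  Arc : Digraph n → Rel (Fin n) 0ℓ
  Arc D u v = v ∈ lookup D u

  outdegree : Digraph n → Fin n → ℕ
  outdegree D v = ∣ lookup D v ∣

  indegree : Digraph n → Fin n → ℕ
  indegree D v = ∣ map (λ row → lookup row v) D ∣

  size : Digraph n → ℕ
  size D = sum (map ∣_∣ D)

  _⊑_ : Rel (Digraph n) 0ℓ
  F ⊑ D = ∀ v → lookup F v ⊆ lookup D v

  EulerianSubdigraph : Digraph n → Digraph n → Set
  EulerianSubdigraph D F = F ⊑ D × (∀ v → outdegree F v ≡ indegree F v)

  eulerianSubdigraph? : Decidable EulerianSubdigraph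
  eulerianSubdigraph? D F =
    all? (λ v → lookup F v ⊆? lookup D v)
      ×-dec all? (λ v → outdegree F v ≟ⁿ indegree F v)

-- If `xs` lists every element of `A` exactly once, then `allVecs xs n` lists
-- every element of `Vec A n` exactly once.
allVecs : {A : Set} → List A → ∀ n → List (Vec A n)
allVecs xs zero    = [] ∷ []
allVecs xs (suc n) = cartesianProductWith _∷_ xs (allVecs xs n)

allDigraphs : ∀ n → List (Digraph n)
allDigraphs n = allVecs (allVecs (false ∷ true ∷ []) n) n

#eulerian : ∀ {n} → Parity → Digraph n → ℕ
#eulerian {n} p D =
  length (filter (λ F → eulerianSubdigraph? D F ×-dec (parity (size F) ≟ᵖ p))
                 (allDigraphs n))

#even #odd : ∀ {n} → Digraph n → ℕ
#even = #eulerian 0ℙ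
#odd  = #eulerian 1ℙ

record IsOrientation {n} (G : Graph n) (D : Digraph n) : Set where
  open Graph G
  field
    sound    : ∀ {u v} → Arc D u v → u ~ v
    complete : ∀ {u v} → u ~ v → Arc D u v ⊎ Arc D v u
    antisym  : ∀ {u v} → Arc D u v → ¬ Arc D v u

AlonTarsi : ∀ {n} → Graph n → ℕ → Set
AlonTarsi G k = ∃[ D ] IsOrientation G D × (∀ v → outdegree D v < k) × #even D ≢ #odd D

record IsMinimum (P : ℕ → Set) (k : ℕ) : Set where
  field
    holds : P k
    least : ∀ {j} → P j → k ≤ j

-- `AT G ≡ k`, with the minimum given by its defining property.
AT_≈_ : ∀ {n} → Graph n → ℕ → Set
AT G ≈ k = IsMinimum (AlonTarsi G) k

{-# OPTIONS --safe #-}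
module Submission where

-- Lower bound: G contains the clique Q₁ ∪ {u} of size m + 1.  Reversing an Eulerian F ⊑ D
-- yields an orientation with the outdegrees of D.  If these are all < j ≤ m, two vertices
-- a, b of the clique have the same score in the tournament induced on it; exchanging a and b
-- in this tournament preserves all outdegrees and flips the parity of the number of reversed
-- arcs.  As the choice of {a , b} depends on the scores only, this is an involution, and
-- #even = #odd.
--
-- Upper bound: orient G as Q₁ → u → Q₂ → v → Q₁ with Q₁ and Q₂ transitive.  An Eulerian
-- subdigraph consists of a flow through Q₁ and a flow through Q₂ of the same value t, so
-- #even − #odd = Σₜ cₜ², where cₜ is the signed number of flows of value t through a
-- transitive tournament.  The only flow of value 0 is empty, hence c₀ = 1.

open import Defs
open import Algebra.Bundles using (CommutativeMonoid; CommutativeRing; CommutativeSemiring)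
import Algebra.Properties.CommutativeMonoid.Sum as CommutativeMonoidSum
import Algebra.Properties.Semiring.Sum as SemiringSum
import Algebra.Solver.CommutativeMonoid as CommutativeMonoidSolver
open import Data.Bool.Base using (Bool; true; false; _∧_; _xor_; if_then_else_; not)
open import Data.Bool.Properties using (∧-zeroʳ; xor-∧-commutativeRing)
open import Data.Empty using (⊥)
open import Data.Fin.Base using (Fin; zero; suc; fromℕ<; toℕ; splitAt; join)
import Data.Fin.Base as Fin using (_<_)
open import Data.Fin.Induction using (<-wellFounded)
import Data.Fin.Permutation as Permutation
import Data.Fin.Permutation.Components as PC
import Data.Fin.Properties as Fin
open import Data.Fin.Subset using (Subset; ∣_∣)
import Data.Fin.Subset as Subset using (⊤)
import Data.Fin.Subset.Properties as Subset
open import Data.Integer.Base as ℤ using (ℤ; 0ℤ; 1ℤ; -1ℤ)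
import Data.Integer.Properties as ℤ
open import Data.List.Base as List using (List; []; _∷_; _++_; filter; length; cartesianProduct)
open import Data.List.Membership.Propositional using (_∈_)
open import Data.List.Membership.Propositional.Properties
  using (∈-filter⁺; ∈-filter⁻; ∈-lookup; ∈-cartesianProduct⁺; ∈-cartesianProductWith⁺)
open import Data.List.Relation.Unary.All as All using ([]; _∷_)
open import Data.List.Relation.Unary.AllPairs using ([]; _∷_)
open import Data.List.Relation.Unary.Any using (here; there; index)
open import Data.List.Relation.Unary.Any.Properties using (lookup-index)
open import Data.List.Relation.Unary.Unique.Propositional using (Unique)
import Data.List.Relation.Unary.Unique.Propositional.Properties as Unique
open import Data.Nat using (ℕ; _≤_; _∸_; _/_)
open import Data.Nat.Base using (zero; suc; _+_; _*_; _<_; parity; z≤n; s≤s; z<s)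
open import Data.Nat.Divisibility using (_∣_; divides)
open import Data.Nat.DivMod using (m*n/n≡m)
import Data.Nat.Properties as ℕ
open import Data.Parity.Base as ℙ using (Parity; 0ℙ; 1ℙ)
import Data.Parity.Properties as ℙ
open import Data.Product.Base using (_×_; _,_; proj₁; proj₂; ∃; ∃₂)
open import Data.Sum.Base using (_⊎_; inj₁; inj₂; [_,_]′)
open import Data.Sum.Function.Propositional using (_⊎-↔_)
open import Data.Unit.Base using (⊤; tt)
open import Data.Vec.Base as Vec using (Vec; []; _∷_; lookup; tabulate)
open import Data.Vec.Properties
  using (lookup-map; lookup∘tabulate; tabulate∘lookup; tabulate-cong; lookup⇒[]=; []=⇒lookup; ∷-injective)
open import Function.Base using (_∘_; id)
open import Function.Bundles using (_↔_; mk↔ₛ′; module Inverse)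
open import Function.Construct.Composition using (_↔-∘_)
open import Function.Construct.Symmetry using (↔-sym)
import Induction.WellFounded as WellFounded
import Level
open import Relation.Binary.Definitions using (tri<; tri≈; tri>)
open import Relation.Binary.PropositionalEquality
open import Relation.Nullary using (Dec; yes; no; does; contradiction)
open import Relation.Nullary.Decidable using (dec-true; dec-false; _×-dec_; ¬?)
open import Relation.Unary using (Decidable)

open Inverse using (to; from; strictlyInverseˡ; strictlyInverseʳ)

private variable
  n : ℕ
  A B : Set

-- Degrees, size and parity as sums over the adjacency matrix.

module Σℕ = CommutativeMonoidSum ℕ.+-0-commutativeMonoid
module Σℙ = CommutativeMonoidSum ℙ.+-0-commutativeMonoid

bit : Bool → ℕ
bit false = 0
bit true  = 1

arc : Digraph n → Fin n → Fin n → Bool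
arc F x y = lookup (lookup F x) y

fromArcs : (Fin n → Fin n → Bool) → Digraph n
fromArcs f = tabulate λ x → tabulate (f x)

arc-fromArcs : ∀ (f : Fin n → Fin n → Bool) x y → arc (fromArcs f) x y ≡ f x y
arc-fromArcs f x y = trans (cong (λ r → lookup r y) (lookup∘tabulate _ x)) (lookup∘tabulate _ y)

lookup-ext : {xs ys : Vec A n} → (∀ i → lookup xs i ≡ lookup ys i) → xs ≡ ys
lookup-ext {xs = xs} {ys} eq =
  trans (sym (tabulate∘lookup xs)) (trans (tabulate-cong eq) (tabulate∘lookup ys))

arc-ext : {F H : Digraph n} → (∀ x y → arc F x y ≡ arc H x y) → F ≡ H
arc-ext eq = lookup-ext λ x → lookup-ext (eq x)

∣∣-sum : (p : Subset n) → ∣ p ∣ ≡ Σℕ.sum (bit ∘ lookup p)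
∣∣-sum []          = refl
∣∣-sum (false ∷ p) = ∣∣-sum p
∣∣-sum (true  ∷ p) = cong suc (∣∣-sum p)

outdegree-sum : ∀ (F : Digraph n) x → outdegree F x ≡ Σℕ.sum λ y → bit (arc F x y)
outdegree-sum F x = ∣∣-sum (lookup F x)

indegree-sum : ∀ (F : Digraph n) y → indegree F y ≡ Σℕ.sum λ x → bit (arc F x y)
indegree-sum F y = trans (∣∣-sum (Vec.map (λ row → lookup row y) F))
  (Σℕ.sum-cong-≗ λ x → cong bit (lookup-map x (λ row → lookup row y) F))

sum-map : ∀ {k} (f : A → ℕ) (v : Vec A k) → Vec.sum (Vec.map f v) ≡ Σℕ.sum (f ∘ lookup v)
sum-map f []      = refl
sum-map f (x ∷ v) = cong (f x +_) (sum-map f v)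

size-sum : (F : Digraph n) → size F ≡ Σℕ.sum λ x → Σℕ.sum λ y → bit (arc F x y)
size-sum F = trans (sum-map ∣_∣ F) (Σℕ.sum-cong-≗ (outdegree-sum F))

parity-sum : ∀ {k} (f : Fin k → ℕ) → parity (Σℕ.sum f) ≡ Σℙ.sum (parity ∘ f)
parity-sum {zero}  f = refl
parity-sum {suc k} f = trans (ℙ.+-homo-+ (f zero) _) (cong (parity (f zero) ℙ.+_) (parity-sum (f ∘ suc)))

parity-size : (F : Digraph n) → parity (size F) ≡ Σℙ.sum λ x → Σℙ.sum λ y → parity (bit (arc F x y))
parity-size F = trans (cong parity (size-sum F))
  (trans (parity-sum λ x → Σℕ.sum λ y → bit (arc F x y)) (Σℙ.sum-cong-≗ λ x → parity-sum (bit ∘ arc F x)))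

⊑-arc : (F D : Digraph n) → F ⊑ D → ∀ x y → arc F x y ≡ true → arc D x y ≡ true
⊑-arc F D F⊑D x y e = []=⇒lookup (F⊑D x (lookup⇒[]= y (lookup F x) e))

arc-⊑ : (F D : Digraph n) → (∀ x y → arc F x y ≡ true → arc D x y ≡ true) → F ⊑ D
arc-⊑ F D h x {y} y∈ = lookup⇒[]= y (lookup D x) (h x y ([]=⇒lookup y∈))

-- Enumeration of digraphs and comparison of counts.

allVecs-unique : ∀ {xs : List A} → Unique xs → ∀ k → Unique (allVecs xs k)
allVecs-unique u zero    = [] ∷ []
allVecs-unique u (suc k) = Unique.cartesianProductWith⁺ _∷_ ∷-injective u (allVecs-unique u k)

∈-allVecs : ∀ {xs : List A} → (∀ x → x ∈ xs) → ∀ {k} (v : Vec A k) → v ∈ allVecs xs k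
∈-allVecs all []      = here refl
∈-allVecs all (x ∷ v) = ∈-cartesianProductWith⁺ _∷_ (all x) (∈-allVecs all v)

allDigraphs-unique : ∀ n → Unique (allDigraphs n)
allDigraphs-unique n = allVecs-unique (allVecs-unique (((λ ()) ∷ []) ∷ [] ∷ []) n) n

∈-allDigraphs : (F : Digraph n) → F ∈ allDigraphs n
∈-allDigraphs = ∈-allVecs (∈-allVecs λ { false → here refl ; true → there (here refl) })

lookup-injective : ∀ {xs : List A} → Unique xs → ∀ {i j} → List.lookup xs i ≡ List.lookup xs j → i ≡ j
lookup-injective (_ ∷ _)  {zero}  {zero}  _  = refl
lookup-injective {xs = _ ∷ xs} (x∉ ∷ _) {zero}  {suc j} eq =
  contradiction eq (All.lookup x∉ (∈-lookup {xs = xs} j))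
lookup-injective {xs = _ ∷ xs} (x∉ ∷ _) {suc i} {zero}  eq =
  contradiction (sym eq) (All.lookup x∉ (∈-lookup {xs = xs} i))
lookup-injective (_ ∷ u)  {suc i} {suc j} eq = cong suc (lookup-injective u eq)

-- Sending a position in the first list to the position of its image gives an injection between
-- finite index sets: `g` recovers the element, and uniqueness of `xs` recovers the position from
-- the element.
length-filter-≤ : ∀ {P : A → Set} {Q : B → Set} (P? : Decidable P) (Q? : Decidable Q)
  {xs ys} → Unique xs → (∀ y → y ∈ ys) →
  (f : A → B) (g : B → A) → (∀ {x} → P x → Q (f x)) → (∀ {x} → P x → g (f x) ≡ x) →
  length (filter P? xs) ≤ length (filter Q? ys)
length-filter-≤ {A = A} {P = P} P? Q? {xs} {ys} u complete f g P⇒Q gf = Fin.injective⇒≤ {f = h} h-injective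
  where
  L = filter P? xs
  Px : ∀ i → P (List.lookup L i)
  Px i = proj₂ (∈-filter⁻ P? {xs = xs} (∈-lookup {xs = L} i))
  mem : ∀ i → f (List.lookup L i) ∈ filter Q? ys
  mem i = ∈-filter⁺ Q? (complete _) (P⇒Q (Px i))
  h : Fin (length L) → Fin (length (filter Q? ys))
  h i = index (mem i)
  h-injective : ∀ {i j} → h i ≡ h j → i ≡ j
  h-injective {i} {j} eq = lookup-injective (Unique.filter⁺ P? u) (begin
    List.lookup L i          ≡⟨ gf (Px i) ⟨
    g (f (List.lookup L i))  ≡⟨ cong g (lookup-index (mem i)) ⟩
    g (List.lookup (filter Q? ys) (h i)) ≡⟨ cong (g ∘ List.lookup (filter Q? ys)) eq ⟩
    g (List.lookup (filter Q? ys) (h j)) ≡⟨ cong g (lookup-index (mem j)) ⟨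
    g (f (List.lookup L j))  ≡⟨ gf (Px j) ⟩
    List.lookup L j          ∎)
    where open ≡-Reasoning

-- Point masses. Over parities they split two vertices off a sum; over the integers they place the
-- sign of an element at its level.
module Pick {c ℓ} (M : CommutativeMonoid c ℓ) where
  open CommutativeMonoid M renaming (ε to 0#; _∙_ to _⊕_; refl to ≈-refl; sym to ≈-sym; trans to ≈-trans)
  open CommutativeMonoidSum M

  pick : Fin n → Carrier → Fin n → Carrier
  pick a v x = if does (x Fin.≟ a) then v else 0#

  sum-zero : (f : Fin n → Carrier) → (∀ i → f i ≡ 0#) → sum f ≈ 0#
  sum-zero {n} f z = ≈-trans (reflexive (sum-cong-≗ z)) (sum-replicate-zero n)

  sum-pick : ∀ (a : Fin n) v → sum (pick a v) ≈ v
  sum-pick {suc n} zero v = ≈-trans (∙-congˡ (sum-zero {n} (λ _ → 0#) λ _ → refl)) (identityʳ v)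
  sum-pick (suc a) v = ≈-trans (identityˡ _) (sum-pick a v)

-- Exchanging two vertices of equal score

module _ {n} {a b : Fin n} (a≢b : a ≢ b) where
  open Σℙ
  open Pick ℙ.+-0-commutativeMonoid

  -- The values at `a` and `b` are overwritten by 0 instead of being removed, so that all sums keep
  -- the index set `Fin n`.
  away : (Fin n → Parity) → Fin n → Parity
  away f x = if does (x Fin.≟ a) then 0ℙ else if does (x Fin.≟ b) then 0ℙ else f x

  sum-away : ∀ f → sum f ≡ f a ℙ.+ f b ℙ.+ sum (away f)
  sum-away f = begin
    sum f                                                                    ≡⟨ sum-cong-≗ pointwise ⟩
    sum (λ x → (pick a (f a) x ℙ.+ pick b (f b) x) ℙ.+ away f x)             ≡⟨ ∑-distrib-+ (λ x → pick a (f a) x ℙ.+ pick b (f b) x) (away f) ⟩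
    sum (λ x → pick a (f a) x ℙ.+ pick b (f b) x) ℙ.+ sum (away f)           ≡⟨ cong (ℙ._+ sum (away f)) (∑-distrib-+ (pick a (f a)) (pick b (f b))) ⟩
    (sum (pick a (f a)) ℙ.+ sum (pick b (f b))) ℙ.+ sum (away f)             ≡⟨ cong (ℙ._+ sum (away f)) (cong₂ ℙ._+_ (sum-pick a (f a)) (sum-pick b (f b))) ⟩
    f a ℙ.+ f b ℙ.+ sum (away f)                                             ∎
    where
    open ≡-Reasoning
    pointwise : ∀ x → f x ≡ (pick a (f a) x ℙ.+ pick b (f b) x) ℙ.+ away f x
    pointwise x with x Fin.≟ a | x Fin.≟ b
    ... | yes refl | yes refl = contradiction refl a≢b
    ... | yes refl | no _     = sym (trans (ℙ.+-identityʳ _) (ℙ.+-identityʳ _))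
    ... | no _     | yes refl = sym (ℙ.+-identityʳ _)
    ... | no _     | no _     = refl

  away-cong : ∀ {f g} → (∀ x → x ≢ a → x ≢ b → f x ≡ g x) → ∀ x → away f x ≡ away g x
  away-cong h x with x Fin.≟ a | x Fin.≟ b
  ... | yes _ | _     = refl
  ... | no _  | yes _ = refl
  ... | no p  | no q  = h x p q

  away-zero : ∀ {f} → (∀ x → x ≢ a → x ≢ b → f x ≡ 0ℙ) → sum (away f) ≡ 0ℙ
  away-zero {f} h = sum-zero (away f) z
    where
    z : ∀ x → away f x ≡ 0ℙ
    z x with x Fin.≟ a | x Fin.≟ b
    ... | yes _ | _     = refl
    ... | no _  | yes _ = refl
    ... | no p  | no q  = h x p q

  away-+ : ∀ f g → sum (away (λ x → f x ℙ.+ g x)) ≡ sum (away f) ℙ.+ sum (away g)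
  away-+ f g = trans (sum-cong-≗ pointwise) (∑-distrib-+ (away f) (away g))
    where
    pointwise : ∀ x → away (λ x → f x ℙ.+ g x) x ≡ away f x ℙ.+ away g x
    pointwise x with x Fin.≟ a | x Fin.≟ b
    ... | yes _ | _     = refl
    ... | no _  | yes _ = refl
    ... | no _  | no _  = refl

  -- The pairs {x , a} and {x , b} contribute equally, which leaves {a , b}.
  sum-pairs-meeting : (W : Fin n → Fin n → Parity) →
    W a a ≡ 0ℙ → W b b ≡ 0ℙ → W a b ℙ.+ W b a ≡ 1ℙ →
    (∀ x y → x ≢ a → x ≢ b → y ≢ a → y ≢ b → W x y ≡ 0ℙ) →
    (∀ x → x ≢ a → x ≢ b → W x a ℙ.+ W a x ≡ W x b ℙ.+ W b x) →
    sum (λ x → sum (W x)) ≡ 1ℙ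
  sum-pairs-meeting W Waa Wbb Wab W0 Wx = begin
    sum (λ x → sum (W x))                       ≡⟨ sum-away (λ x → sum (W x)) ⟩
    sum (W a) ℙ.+ sum (W b) ℙ.+ sum (away λ x → sum (W x))
      ≡⟨ cong₂ ℙ._+_ (cong₂ ℙ._+_ rowa rowb) rows ⟩
    (W a b ℙ.+ α) ℙ.+ (W b a ℙ.+ β) ℙ.+ (γ ℙ.+ δ) ≡⟨ rearrange (W a b) (W b a) α β γ δ ⟩
    (W a b ℙ.+ W b a) ℙ.+ ((γ ℙ.+ α) ℙ.+ (δ ℙ.+ β)) ≡⟨ cong₂ ℙ._+_ Wab cancel ⟩
    1ℙ                                        ∎
    where
    open ≡-Reasoning
    α β γ δ : Parity
    α = sum (away (W a))
    β = sum (away (W b))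
    γ = sum (away λ x → W x a)
    δ = sum (away λ x → W x b)
    rowa : sum (W a) ≡ W a b ℙ.+ α
    rowa = trans (sum-away (W a)) (cong (λ w → w ℙ.+ W a b ℙ.+ α) Waa)
    rowb : sum (W b) ≡ W b a ℙ.+ β
    rowb = trans (sum-away (W b)) (cong (ℙ._+ β) (trans (cong (W b a ℙ.+_) Wbb) (ℙ.+-identityʳ (W b a))))
    rows : sum (away λ x → sum (W x)) ≡ γ ℙ.+ δ
    -- In a row `x` other than `a` and `b`, only the columns `a` and `b` can be nonzero.
    rows = trans (sum-cong-≗ (away-cong λ x x≢a x≢b →
                   trans (sum-away (W x))
                     (trans (cong (W x a ℙ.+ W x b ℙ.+_) (away-zero λ y → W0 x y x≢a x≢b)) (ℙ.+-identityʳ _))))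
                 (away-+ (λ x → W x a) (λ x → W x b))
    cancel : (γ ℙ.+ α) ℙ.+ (δ ℙ.+ β) ≡ 0ℙ
    cancel = begin
      (γ ℙ.+ α) ℙ.+ (δ ℙ.+ β)
        ≡⟨ cong₂ ℙ._+_ (away-+ (λ x → W x a) (W a)) (away-+ (λ x → W x b) (W b)) ⟨
      sum (away λ x → W x a ℙ.+ W a x) ℙ.+ sum (away λ x → W x b ℙ.+ W b x)
        ≡⟨ cong (ℙ._+ sum (away λ x → W x b ℙ.+ W b x)) (sum-cong-≗ (away-cong Wx)) ⟩
      sum (away λ x → W x b ℙ.+ W b x) ℙ.+ sum (away λ x → W x b ℙ.+ W b x)
        ≡⟨ ℙ.p+p≡0ℙ (sum (away λ x → W x b ℙ.+ W b x)) ⟩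
      0ℙ ∎
    rearrange : ∀ u v p q r s → (u ℙ.+ p) ℙ.+ (v ℙ.+ q) ℙ.+ (r ℙ.+ s) ≡ (u ℙ.+ v) ℙ.+ ((r ℙ.+ p) ℙ.+ (s ℙ.+ q))
    rearrange = solve 6 (λ u v p q r s → ((u ⊕ p) ⊕ (v ⊕ q)) ⊕ (r ⊕ s) ⊜ (u ⊕ v) ⊕ ((r ⊕ p) ⊕ (s ⊕ q))) refl
      where open CommutativeMonoidSolver ℙ.+-0-commutativeMonoid

transpose-hitˡ : ∀ (a b : Fin n) → PC.transpose a b a ≡ b
transpose-hitˡ a b rewrite dec-true (a Fin.≟ a) refl = refl

transpose-hitʳ : ∀ (a b : Fin n) → PC.transpose a b b ≡ a
transpose-hitʳ a b with b Fin.≟ a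
... | yes b≡a = b≡a
... | no _ rewrite dec-true (b Fin.≟ b) refl = refl

transpose-miss : ∀ {a b x : Fin n} → x ≢ a → x ≢ b → PC.transpose a b x ≡ x
transpose-miss {a = a} {b} {x} x≢a x≢b
  rewrite dec-false (x Fin.≟ a) x≢a | dec-false (x Fin.≟ b) x≢b = refl

transpose-involutive : ∀ (a b x : Fin n) → PC.transpose a b (PC.transpose a b x) ≡ x
transpose-involutive a b x with x Fin.≟ a
... | yes x≡a = trans (transpose-hitʳ a b) (sym x≡a)
... | no x≢a with x Fin.≟ b
...   | yes x≡b = trans (transpose-hitˡ a b) (sym x≡b)
...   | no x≢b  = transpose-miss x≢a x≢b

-- Reversing an Eulerian subdigraph and relabelling a tournament.

Balanced : Digraph n → Set
Balanced F = ∀ v → outdegree F v ≡ indegree F v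

module Swap {n} (D : Digraph n)
  (antisym : ∀ x y → arc D x y ∧ arc D y x ≡ false)
  (q : Fin n → Bool)
  (tournament : ∀ x y → q x ≡ true → q y ≡ true → x ≢ y → arc D x y xor arc D y x ≡ true)
  where

  -- For `F ⊑ D`: the orientation obtained from `D` by reversing the arcs of `F`.
  rev : Digraph n → Fin n → Fin n → Bool
  rev F x y = arc D x y xor (arc F x y xor arc F y x)

  revdeg : Digraph n → Fin n → ℕ
  revdeg F x = Σℕ.sum λ y → bit (rev F x y)

  -- For `x` in `q` this is the score of `x` in the tournament that the reversed orientation induces
  -- on `q`.
  score : Digraph n → Fin n → ℕ
  score F x = Σℕ.sum λ y → bit (q y ∧ rev F x y)

  loopless : ∀ x → arc D x x ≡ false
  loopless x with arc D x x | antisym x x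
  ... | false | _ = refl

  -- Reversing an arc of `F` leaving `x` costs one outgoing arc, and reversing one entering `x`
  -- gains one. The outdegree in `F` is moved to the left to avoid truncated subtraction.
  rev-outdegree : ∀ F → F ⊑ D → ∀ x → revdeg F x + outdegree F x ≡ outdegree D x + indegree F x
  rev-outdegree F F⊑D x = begin
    revdeg F x + outdegree F x                                      ≡⟨ cong (revdeg F x +_) (outdegree-sum F x) ⟩
    revdeg F x + Σℕ.sum (λ y → bit (arc F x y))                     ≡⟨ Σℕ.∑-distrib-+ (λ y → bit (rev F x y)) (λ y → bit (arc F x y)) ⟨
    Σℕ.sum (λ y → bit (rev F x y) + bit (arc F x y))                ≡⟨ Σℕ.sum-cong-≗ (λ y → pointwise (arc D x y) (arc D y x) (arc F x y) (arc F y x) (antisym x y) (⊑-arc F D F⊑D x y) (⊑-arc F D F⊑D y x)) ⟩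
    Σℕ.sum (λ y → bit (arc D x y) + bit (arc F y x))                ≡⟨ Σℕ.∑-distrib-+ (λ y → bit (arc D x y)) (λ y → bit (arc F y x)) ⟩
    Σℕ.sum (λ y → bit (arc D x y)) + Σℕ.sum (λ y → bit (arc F y x)) ≡⟨ cong₂ _+_ (outdegree-sum D x) (indegree-sum F x) ⟨
    outdegree D x + indegree F x                                    ∎
    where
    open ≡-Reasoning
    pointwise : ∀ d d′ f f′ → d ∧ d′ ≡ false → (f ≡ true → d ≡ true) → (f′ ≡ true → d′ ≡ true) →
                bit (d xor (f xor f′)) + bit f ≡ bit d + bit f′
    pointwise true  true  _     _     () _ _
    pointwise true  false true  true  _ _ h with h refl
    ... | ()
    pointwise true  false true  false _ _ _ = refl
    pointwise true  false false true  _ _ h with h refl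
    ... | ()
    pointwise true  false false false _ _ _ = refl
    pointwise false d′    true  _     _ h _ with h refl
    ... | ()
    pointwise false d′    false f′    _ _ _ = ℕ.+-identityʳ (bit f′)

  -- Cancelling the equal degrees of `F` in `rev-outdegree`. With the converse below, being Eulerian
  -- becomes a condition on the outdegrees of the reversed orientation alone.
  balanced⇒revdeg : ∀ F → F ⊑ D → Balanced F → ∀ x → revdeg F x ≡ outdegree D x
  balanced⇒revdeg F F⊑D bal x = ℕ.+-cancelʳ-≡ (outdegree F x) _ _
    (trans (rev-outdegree F F⊑D x) (cong (outdegree D x +_) (sym (bal x))))

  revdeg⇒balanced : ∀ F → F ⊑ D → (∀ x → revdeg F x ≡ outdegree D x) → Balanced F
  revdeg⇒balanced F F⊑D eq x = ℕ.+-cancelˡ-≡ (outdegree D x) _ _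
    (trans (cong (_+ outdegree F x) (sym (eq x))) (rev-outdegree F F⊑D x))

  score≤revdeg : ∀ F x → score F x ≤ revdeg F x
  score≤revdeg F x = sum-mono λ y → bit-∧ (q y) (rev F x y)
    where
    sum-mono : ∀ {k} {f g : Fin k → ℕ} → (∀ i → f i ≤ g i) → Σℕ.sum f ≤ Σℕ.sum g
    sum-mono {zero}  h = z≤n
    sum-mono {suc k} h = ℕ.+-mono-≤ (h zero) (sum-mono (h ∘ suc))
    bit-∧ : ∀ u v → bit (u ∧ v) ≤ bit v
    bit-∧ true  v = ℕ.≤-refl
    bit-∧ false v = z≤n

  module _ {a b : Fin n} (qa : q a ≡ true) (qb : q b ≡ true) (a≢b : a ≢ b) where

    τ : Fin n → Fin n
    τ = PC.transpose a b

    qτ : ∀ x → q (τ x) ≡ q x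
    qτ x with x Fin.≟ a
    ... | yes refl = trans qb (sym qa)
    ... | no _ with x Fin.≟ b
    ...   | yes refl = trans qa (sym qb)
    ...   | no _     = refl

    τ-injective : ∀ {x y} → τ x ≡ τ y → x ≡ y
    τ-injective {x} {y} eq =
      trans (sym (transpose-involutive a b x)) (trans (cong τ eq) (transpose-involutive a b y))

    -- The pairs in the clique `q` whose orientation changes when the tournament on `q` is
    -- relabelled by τ.
    change : Digraph n → Fin n → Fin n → Bool
    change F x y = (q x ∧ q y) ∧ (rev F x y xor rev F (τ x) (τ y))

    -- The factor `arc D x y` selects the direction that `D` uses on a changed pair, so each such
    -- pair is flipped exactly once and the result stays inside `D`.
    toggle : Digraph n → Digraph n
    toggle F = fromArcs λ x y → arc F x y xor (arc D x y ∧ change F x y)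

    arc-toggle : ∀ F x y → arc (toggle F) x y ≡ arc F x y xor (arc D x y ∧ change F x y)
    arc-toggle F = arc-fromArcs _

    toggle-⊑ : ∀ F → F ⊑ D → toggle F ⊑ D
    toggle-⊑ F F⊑D = arc-⊑ (toggle F) D λ x y e →
      pointwise (arc F x y) (arc D x y) (change F x y) (⊑-arc F D F⊑D x y) (trans (sym (arc-toggle F x y)) e)
      where
      pointwise : ∀ f d e → (f ≡ true → d ≡ true) → f xor (d ∧ e) ≡ true → d ≡ true
      pointwise f     true  e _ _ = refl
      pointwise true  false e h _ = h refl

    -- Exactly one direction of a clique pair lies in `D`, and reversal negates both entries or
    -- neither: the reversed orientation is again a tournament on `q`.
    rev-sym : ∀ F {x y} → q x ≡ true → q y ≡ true → x ≢ y → rev F y x ≡ not (rev F x y)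
    rev-sym F {x} {y} qx qy x≢y =
      pointwise (arc D x y) (arc D y x) (arc F x y) (arc F y x) (tournament x y qx qy x≢y)
      where
      pointwise : ∀ d d′ f f′ → d xor d′ ≡ true → d′ xor (f′ xor f) ≡ not (d xor (f xor f′))
      pointwise true  false true  true  _ = refl
      pointwise true  false true  false _ = refl
      pointwise true  false false true  _ = refl
      pointwise true  false false false _ = refl
      pointwise false true  true  true  _ = refl
      pointwise false true  true  false _ = refl
      pointwise false true  false true  _ = refl
      pointwise false true  false false _ = refl

    rev-loopless : ∀ F x → rev F x x ≡ false
    rev-loopless F x rewrite loopless x with arc F x x
    ... | true  = refl
    ... | false = refl

    change-loopless : ∀ F x → change F x x ≡ false
    change-loopless F x rewrite rev-loopless F x | rev-loopless F (τ x) with q x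
    ... | true  = refl
    ... | false = refl

    -- By `rev-sym`, interchanging two distinct ends in `q` negates both operands of the `xor`,
    -- which leaves it unchanged.
    change-sym : ∀ F x y → change F y x ≡ change F x y
    change-sym F x y with x Fin.≟ y
    ... | yes refl = refl
    ... | no x≢y with q x in qx | q y in qy
    ...   | false | false = refl
    ...   | false | true  = refl
    ...   | true  | false = refl
    ...   | true  | true
      rewrite rev-sym F qx qy x≢y
            | rev-sym F (trans (qτ x) qx) (trans (qτ y) qy) (x≢y ∘ τ-injective)
      with rev F x y | rev F (τ x) (τ y)
    ...     | true  | true  = refl
    ...     | true  | false = refl
    ...     | false | true  = refl
    ...     | false | false = refl

    -- A pair inside `q` carries exactly one arc of `D`; for a loop or a pair not inside `q`,
    -- `change` is already false.
    change-on-arcs : ∀ F x y → (arc D x y ∧ change F x y) xor (arc D y x ∧ change F x y) ≡ change F x y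
    change-on-arcs F x y with x Fin.≟ y
    ... | yes refl rewrite change-loopless F x with arc D x x
    ...   | true  = refl
    ...   | false = refl
    change-on-arcs F x y | no x≢y with q x in qx | q y in qy
    ...   | false | _ = cong₂ _xor_ (∧-zeroʳ (arc D x y)) (∧-zeroʳ (arc D y x))
    ...   | true | false = cong₂ _xor_ (∧-zeroʳ (arc D x y)) (∧-zeroʳ (arc D y x))
    ...   | true | true = pointwise (arc D x y) (arc D y x) _ (tournament x y qx qy x≢y)
      where
      pointwise : ∀ d d′ e → d xor d′ ≡ true → (d ∧ e) xor (d′ ∧ e) ≡ e
      pointwise true  false true  _ = refl
      pointwise true  false false _ = refl
      pointwise false true  _     _ = refl

    -- Since `rev` is affine over `xor`, the toggled arcs of both directions add up, and
    -- `change-on-arcs` collapses them. For `x` and `y` in `q` the right-hand side is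
    -- `rev F (τ x) (τ y)`: the tournament is relabelled by `τ`.
    rev-toggle : ∀ F x y → rev (toggle F) x y ≡ rev F x y xor change F x y
    rev-toggle F x y rewrite arc-toggle F x y | arc-toggle F y x | change-sym F x y =
      pointwise (arc D x y) (arc D y x) (arc F x y) (arc F y x) (change F x y) (change-on-arcs F x y)
      where
      shuffle : ∀ d f f′ u v → d xor ((f xor u) xor (f′ xor v)) ≡ (d xor (f xor f′)) xor (u xor v)
      shuffle = solve 5 (λ d f f′ u v → d ⊕ ((f ⊕ u) ⊕ (f′ ⊕ v)) ⊜ (d ⊕ (f ⊕ f′)) ⊕ (u ⊕ v)) refl
        where
        open CommutativeMonoidSolver (CommutativeRing.+-commutativeMonoid xor-∧-commutativeRing)
      pointwise : ∀ d d′ f f′ e → (d ∧ e) xor (d′ ∧ e) ≡ e →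
        d xor ((f xor (d ∧ e)) xor (f′ xor (d′ ∧ e))) ≡ (d xor (f xor f′)) xor e
      pointwise d d′ f f′ e h = trans (shuffle d f f′ (d ∧ e) (d′ ∧ e)) (cong ((d xor (f xor f′)) xor_) h)

    -- As `τ` is an involution preserving `q`, it merely exchanges the two operands of the `xor`.
    change-τ : ∀ F x y → change F (τ x) (τ y) ≡ change F x y
    change-τ F x y
      rewrite qτ x | qτ y | transpose-involutive a b x | transpose-involutive a b y
      with rev F x y | rev F (τ x) (τ y)
    ... | true  | true  = refl
    ... | true  | false = refl
    ... | false | true  = refl
    ... | false | false = refl

    -- Toggling adds `change F x y` to one operand and `change F (τ x) (τ y)` to the other; these
    -- agree by `change-τ` and cancel. Hence a second toggle flips the same arcs back.
    change-toggle : ∀ F x y → change (toggle F) x y ≡ change F x y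
    change-toggle F x y
      rewrite rev-toggle F x y | rev-toggle F (τ x) (τ y) | change-τ F x y =
      cong ((q x ∧ q y) ∧_) (cancel (rev F x y) (rev F (τ x) (τ y)) (change F x y))
      where
      cancel : ∀ u v e → (u xor e) xor (v xor e) ≡ u xor v
      cancel true  true  true  = refl
      cancel true  true  false = refl
      cancel true  false true  = refl
      cancel true  false false = refl
      cancel false true  true  = refl
      cancel false true  false = refl
      cancel false false true  = refl
      cancel false false false = refl

    toggle-involutive : ∀ F → toggle (toggle F) ≡ F
    toggle-involutive F = arc-ext λ x y →
      trans (arc-toggle (toggle F) x y)
        (trans (cong₂ (λ f e → f xor (arc D x y ∧ e)) (arc-toggle F x y) (change-toggle F x y))
          (cancel (arc F x y) (arc D x y ∧ change F x y)))
      where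
      cancel : ∀ f e → (f xor e) xor e ≡ f
      cancel true  true  = refl
      cancel true  false = refl
      cancel false true  = refl
      cancel false false = refl

    -- The toggled arcs are counted by `W`, and `sum-pairs-meeting` shows that their number is odd.
    toggle-parity : ∀ F → parity (size (toggle F)) ≡ parity (size F) ℙ.+ 1ℙ
    toggle-parity F = begin
      parity (size (toggle F))
        ≡⟨ parity-size (toggle F) ⟩
      Σℙ.sum (λ x → Σℙ.sum λ y → β (arc (toggle F) x y))
        ≡⟨ Σℙ.sum-cong-≗ (λ x → trans (Σℙ.sum-cong-≗ λ y → trans (cong β (arc-toggle F x y)) (β-xor (arc F x y) _)) (Σℙ.∑-distrib-+ (λ y → β (arc F x y)) (W x))) ⟩
      Σℙ.sum (λ x → Σℙ.sum (λ y → β (arc F x y)) ℙ.+ Σℙ.sum (W x))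
        ≡⟨ Σℙ.∑-distrib-+ (λ x → Σℙ.sum (λ y → β (arc F x y))) (λ x → Σℙ.sum (W x)) ⟩
      Σℙ.sum (λ x → Σℙ.sum (λ y → β (arc F x y))) ℙ.+ Σℙ.sum (λ x → Σℙ.sum (W x))
        ≡⟨ cong₂ ℙ._+_ (sym (parity-size F)) (sum-pairs-meeting a≢b W (Wxx a) (Wxx b) Wab W0 Wx) ⟩
      parity (size F) ℙ.+ 1ℙ ∎
      where
      open ≡-Reasoning
      β : Bool → Parity
      β u = parity (bit u)
      β-xor : ∀ u v → β (u xor v) ≡ β u ℙ.+ β v
      β-xor true  true  = refl
      β-xor true  false = refl
      β-xor false true  = refl
      β-xor false false = refl
      W : Fin n → Fin n → Parity
      W x y = β (arc D x y ∧ change F x y)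
      W+W : ∀ x y → W x y ℙ.+ W y x ≡ β (change F x y)
      W+W x y = trans (sym (β-xor (arc D x y ∧ change F x y) (arc D y x ∧ change F y x)))
        (cong β (trans (cong (λ e → (arc D x y ∧ change F x y) xor (arc D y x ∧ e)) (change-sym F x y)) (change-on-arcs F x y)))
      Wxx : ∀ x → W x x ≡ 0ℙ
      Wxx x rewrite loopless x = refl
      Wab : W a b ℙ.+ W b a ≡ 1ℙ
      Wab = trans (W+W a b) (cong β changed)
        where
        changed : change F a b ≡ true
        -- `τ` reverses the pair `a`, `b`, and a tournament orients a reversed pair oppositely.
        changed rewrite qa | qb | transpose-hitˡ a b | transpose-hitʳ a b | rev-sym F qa qb a≢b with rev F a b
        ... | true  = refl
        ... | false = refl
      W0 : ∀ x y → x ≢ a → x ≢ b → y ≢ a → y ≢ b → W x y ≡ 0ℙ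
      -- `τ` fixes both ends, so the two operands of `change` coincide.
      W0 x y x≢a x≢b y≢a y≢b
        rewrite transpose-miss x≢a x≢b | transpose-miss y≢a y≢b
        with arc D x y | q x ∧ q y | rev F x y
      ... | true  | true  | true  = refl
      ... | true  | true  | false = refl
      ... | true  | false | _     = refl
      ... | false | _     | _     = refl
      Wx : ∀ x → x ≢ a → x ≢ b → W x a ℙ.+ W a x ≡ W x b ℙ.+ W b x
      Wx x x≢a x≢b = trans (W+W x a) (trans (cong β same) (sym (W+W x b)))
        where
        same : change F x a ≡ change F x b
        -- `τ` fixes `x` and carries `a` to `b`.
        same = trans (sym (change-τ F x a)) (cong₂ (change F) (transpose-miss x≢a x≢b) (transpose-hitˡ a b))

    module _ (F : Digraph n) (tie : score F a ≡ score F b) where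

      -- The tie enters here: `τ` moves only `a` and `b`, whose scores agree.
      score-τ : ∀ x → score F (τ x) ≡ score F x
      score-τ x with x Fin.≟ a
      ... | yes refl = sym tie
      ... | no _ with x Fin.≟ b
      ...   | yes refl = tie
      ...   | no _     = refl

      -- Relabelling by `τ` gives `x` the old score of `τ x`, after reindexing the sum by `τ`; by
      -- the tie this is the old score of `x`.
      score-toggle : ∀ x → q x ≡ true → score (toggle F) x ≡ score F x
      score-toggle x qx = begin
        score (toggle F) x                                  ≡⟨ Σℕ.sum-cong-≗ (λ y → cong bit (pointwise y)) ⟩
        Σℕ.sum (λ y → bit (q (τ y) ∧ rev F (τ x) (τ y)))    ≡⟨ Σℕ.sum-permute (λ y → bit (q y ∧ rev F (τ x) y)) (Permutation.transpose a b) ⟨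
        score F (τ x)                                       ≡⟨ score-τ x ⟩
        score F x                                           ∎
        where
        open ≡-Reasoning
        pointwise : ∀ y → q y ∧ rev (toggle F) x y ≡ q (τ y) ∧ rev F (τ x) (τ y)
        pointwise y rewrite rev-toggle F x y | qτ y | qx with q y | rev F x y | rev F (τ x) (τ y)
        ... | false | _     | _     = refl
        ... | true  | false | _     = refl
        ... | true  | true  | true  = refl
        ... | true  | true  | false = refl

      -- Pairs with an end outside `q` are untouched, and the part of the outdegree inside `q` is
      -- the score.
      revdeg-toggle : ∀ x → revdeg (toggle F) x ≡ revdeg F x
      revdeg-toggle x with q x in qx
      ... | false = Σℕ.sum-cong-≗ λ y → cong bit (unchanged y)
        where
        unchanged : ∀ y → rev (toggle F) x y ≡ rev F x y
        unchanged y rewrite rev-toggle F x y | qx with rev F x y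
        ... | true  = refl
        ... | false = refl
      ... | true = begin
        revdeg (toggle F) x              ≡⟨ decompose (toggle F) ⟩
        score (toggle F) x + Σℕ.sum (λ y → bit (not (q y) ∧ rev (toggle F) x y)) ≡⟨ cong₂ _+_ (score-toggle x qx) (Σℕ.sum-cong-≗ λ y → cong bit (unchanged y)) ⟩
        score F x + Σℕ.sum (λ y → bit (not (q y) ∧ rev F x y)) ≡⟨ decompose F ⟨
        revdeg F x                       ∎
        where
        open ≡-Reasoning
        split : ∀ u v → bit v ≡ bit (u ∧ v) + bit (not u ∧ v)
        split true  v = sym (ℕ.+-identityʳ (bit v))
        split false v = refl
        decompose : ∀ H → revdeg H x ≡ score H x + Σℕ.sum (λ y → bit (not (q y) ∧ rev H x y))
        decompose H = trans (Σℕ.sum-cong-≗ λ y → split (q y) (rev H x y))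
          (Σℕ.∑-distrib-+ (λ y → bit (q y ∧ rev H x y)) (λ y → bit (not (q y) ∧ rev H x y)))
        unchanged : ∀ y → not (q y) ∧ rev (toggle F) x y ≡ not (q y) ∧ rev F x y
        unchanged y rewrite rev-toggle F x y | qx with q y | rev F x y
        ... | true  | _     = refl
        ... | false | true  = refl
        ... | false | false = refl

      toggle-eulerian : EulerianSubdigraph D F → EulerianSubdigraph D (toggle F)
      toggle-eulerian (F⊑D , bal) = toggle-⊑ F F⊑D , revdeg⇒balanced (toggle F) (toggle-⊑ F F⊑D)
        λ x → trans (revdeg-toggle x) (balanced⇒revdeg F F⊑D bal x)

-- Cliques as lower bounds for the Alon-Tarsi number.

module OrientationArcs {G : Graph n} {D : Digraph n} (orientation : IsOrientation G D) where
  open Graph G using (_~_)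
  open IsOrientation orientation

  arc⇒Arc : ∀ {x y} → arc D x y ≡ true → Arc D x y
  arc⇒Arc {x} {y} = lookup⇒[]= y (lookup D x)

  arc-antisym : ∀ x y → arc D x y ∧ arc D y x ≡ false
  arc-antisym x y with arc D x y in xy | arc D y x in yx
  ... | true  | true  = contradiction (arc⇒Arc yx) (antisym (arc⇒Arc xy))
  ... | true  | false = refl
  ... | false | _     = refl

  arc-complete : ∀ {x y} → x ~ y → arc D x y xor arc D y x ≡ true
  arc-complete {x} {y} x~y with arc D x y in xy | arc D y x in yx | complete x~y
  ... | true  | false | _      = refl
  ... | false | true  | _      = refl
  ... | true  | true  | _      = contradiction (arc⇒Arc yx) (antisym (arc⇒Arc xy))
  ... | false | false | inj₁ p with trans (sym xy) ([]=⇒lookup p)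
  ...   | ()
  arc-complete {x} {y} x~y | false | false | inj₂ p with trans (sym yx) ([]=⇒lookup p)
  ...   | ()

module CliqueBound {s j} {G : Graph n} {D : Digraph n} (orientation : IsOrientation G D)
  (c : Fin s → Fin n) (clique : ∀ {i k} → i ≢ k → Graph._~_ G (c i) (c k))
  (outdegree<j : ∀ v → outdegree D v < j) (j<s : j < s)
  where
  open OrientationArcs orientation

  c-injective : ∀ {i k} → i ≢ k → c i ≢ c k
  c-injective i≢k ci≡ck = Graph.irrefl G ci≡ck (clique i≢k)

  onClique? : ∀ x → Dec (∃ λ i → c i ≡ x)
  onClique? x = Fin.any? λ i → c i Fin.≟ x

  q : Fin n → Bool
  q x = does (onClique? x)

  qc : ∀ i → q (c i) ≡ true
  qc i = dec-true (onClique? (c i)) (i , refl)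

  tournament : ∀ x y → q x ≡ true → q y ≡ true → x ≢ y → arc D x y xor arc D y x ≡ true
  tournament x y qx qy x≢y with onClique? x | onClique? y
  tournament x y qx qy x≢y | yes (i , refl) | yes (k , refl) = arc-complete (clique (x≢y ∘ cong c))

  open Swap D arc-antisym q tournament

  -- A property of score vectors, not of digraphs: digraphs with equal scores then get the same pair
  -- from `tie?`. Vectors make equality of all scores a propositional equality that can be
  -- substituted.
  Tie : Vec ℕ s → Set
  Tie v = ∃₂ λ i k → i ≢ k × lookup v i ≡ lookup v k

  tie? : ∀ v → Dec (Tie v)
  tie? v = Fin.any? λ i → Fin.any? λ k → ¬? (i Fin.≟ k) ×-dec (lookup v i ℕ.≟ lookup v k)

  scores : Digraph n → Vec ℕ s
  scores F = tabulate (score F ∘ c)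

  scores-tie : ∀ F {i k} → lookup (scores F) i ≡ lookup (scores F) k → score F (c i) ≡ score F (c k)
  scores-tie F {i} {k} eq = trans (sym (lookup∘tabulate _ i)) (trans eq (lookup∘tabulate _ k))

  -- The decision is a separate argument so that `involutive` can split on it once for both
  -- applications.
  toggleTie : ∀ v → Dec (Tie v) → Digraph n → Digraph n
  toggleTie v (yes (i , k , i≢k , _)) = toggle (qc i) (qc k) (c-injective i≢k)
  -- A filler value: by `tie`, Eulerian subdigraphs never reach this case.
  toggleTie v (no _)                  = λ F → F

  involution : Digraph n → Digraph n
  involution F = toggleTie (scores F) (tie? (scores F)) F

  scores-involution : ∀ F → scores (involution F) ≡ scores F
  scores-involution F with tie? (scores F)
  ... | yes (i , k , i≢k , eq) =
    tabulate-cong λ l → score-toggle (qc i) (qc k) (c-injective i≢k) F (scores-tie F eq) (c l) (qc l)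
  ... | no _ = refl

  involutive : ∀ F → involution (involution F) ≡ F
  -- The outer application chooses its pair from the scores of `involution F`; these are the scores
  -- of `F`, so it makes the same choice.
  involutive F = trans (cong (λ v → toggleTie v (tie? v) (involution F)) (scores-involution F))
                       (toggleTie-involutive (scores F) (tie? (scores F)))
    where
    toggleTie-involutive : ∀ v (t : Dec (Tie v)) → toggleTie v t (toggleTie v t F) ≡ F
    toggleTie-involutive v (yes (i , k , i≢k , _)) = toggle-involutive (qc i) (qc k) (c-injective i≢k) F
    toggleTie-involutive v (no _)                  = refl

  -- Every score is at most an outdegree of the reversed orientation, which is an outdegree of `D`
  -- and so below `j`. Thus `s` scores take fewer than `s` values.
  tie : ∀ F → EulerianSubdigraph D F → Tie (scores F)
  tie F (F⊑D , bal) =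
    let i , k , i<k , eq = Fin.pigeonhole j<s λ l → fromℕ< (score<j l)
    in i , k , Fin.<⇒≢ i<k ,
       trans (lookup∘tabulate (score F ∘ c) i)
         (trans (Fin.fromℕ<-injective _ _ (score<j i) (score<j k) eq) (sym (lookup∘tabulate (score F ∘ c) k)))
    where
    score<j : ∀ l → score F (c l) < j
    score<j l = ℕ.≤-<-trans (score≤revdeg F (c l))
      (subst (_< j) (sym (balanced⇒revdeg F F⊑D bal (c l))) (outdegree<j (c l)))

  involution-eulerian : ∀ F → EulerianSubdigraph D F → EulerianSubdigraph D (involution F)
  involution-eulerian F eu with tie? (scores F)
  ... | yes (i , k , i≢k , eq) = toggle-eulerian (qc i) (qc k) (c-injective i≢k) F (scores-tie F eq) eu
  ... | no _                   = eu

  involution-parity : ∀ F → EulerianSubdigraph D F →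
                      parity (size (involution F)) ≡ parity (size F) ℙ.+ 1ℙ
  involution-parity F eu with tie? (scores F)
  ... | yes (i , k , i≢k , eq) = toggle-parity (qc i) (qc k) (c-injective i≢k) F
  ... | no ¬tie                = contradiction (tie F eu) ¬tie

  #eulerian-≤ : ∀ p → #eulerian p D ≤ #eulerian (p ℙ.+ 1ℙ) D
  #eulerian-≤ p = length-filter-≤
    (λ F → eulerianSubdigraph? D F ×-dec (parity (size F) ℙ.≟ p))
    (λ F → eulerianSubdigraph? D F ×-dec (parity (size F) ℙ.≟ p ℙ.+ 1ℙ))
    (allDigraphs-unique n) ∈-allDigraphs involution involution
    (λ {F} (eu , e) → involution-eulerian F eu , trans (involution-parity F eu) (cong (ℙ._+ 1ℙ) e))
    (λ {F} _ → involutive F)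

  #even≡#odd : #even D ≡ #odd D
  -- `1ℙ ℙ.+ 1ℙ` reduces to `0ℙ`, so the second instance is the reverse inequality.
  #even≡#odd = ℕ.≤-antisym (#eulerian-≤ 0ℙ) (#eulerian-≤ 1ℙ)

clique≤AlonTarsi : ∀ {s j} (G : Graph n) (c : Fin s → Fin n) →
                   (∀ {i k} → i ≢ k → Graph._~_ G (c i) (c k)) → AlonTarsi G j → s ≤ j
clique≤AlonTarsi G c clique (D , orientation , outdegree<j , even≢odd) =
  ℕ.≮⇒≥ λ j<s → even≢odd (CliqueBound.#even≡#odd orientation c clique outdegree<j j<s)

-- Signed counts of matched pairs

module Σℤ = SemiringSum (CommutativeSemiring.semiring ℤ.+-*-commutativeSemiring)
module Pickℤ = Pick ℤ.+-0-commutativeMonoid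

sign : Parity → ℤ
sign 0ℙ = 1ℤ
sign 1ℙ = -1ℤ

sign-+ : ∀ p r → sign (p ℙ.+ r) ≡ sign p ℤ.* sign r
sign-+ 0ℙ r  = sym (ℤ.*-identityˡ (sign r))
sign-+ 1ℙ 0ℙ = refl
sign-+ 1ℙ 1ℙ = refl

∑ : List A → (A → ℤ) → ℤ
∑ []       f = 0ℤ
∑ (x ∷ xs) f = f x ℤ.+ ∑ xs f

∑-cong : ∀ (xs : List A) {f g} → (∀ x → f x ≡ g x) → ∑ xs f ≡ ∑ xs g
∑-cong []       h = refl
∑-cong (x ∷ xs) h = cong₂ ℤ._+_ (h x) (∑-cong xs h)

∑-++ : ∀ (xs ys : List A) f → ∑ (xs ++ ys) f ≡ ∑ xs f ℤ.+ ∑ ys f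
∑-++ []       ys f = sym (ℤ.+-identityˡ _)
∑-++ (x ∷ xs) ys f = trans (cong (ℤ._+_ (f x)) (∑-++ xs ys f)) (sym (ℤ.+-assoc (f x) (∑ xs f) (∑ ys f)))

∑-map : ∀ (g : A → B) xs f → ∑ (List.map g xs) f ≡ ∑ xs (f ∘ g)
∑-map g []       f = refl
∑-map g (x ∷ xs) f = cong (ℤ._+_ (f (g x))) (∑-map g xs f)

∑-cartesianProduct : ∀ (xs : List A) (ys : List B) f →
                     ∑ (cartesianProduct xs ys) f ≡ ∑ xs λ x → ∑ ys λ y → f (x , y)
∑-cartesianProduct []       ys f = refl
∑-cartesianProduct (x ∷ xs) ys f =
  trans (∑-++ (List.map (x ,_) ys) (cartesianProduct xs ys) f)
        (cong₂ ℤ._+_ (∑-map (x ,_) ys f) (∑-cartesianProduct xs ys f))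

∑-*-sum : ∀ {k} (xs : List A) (g : A → Fin k → ℤ) (h : Fin k → ℤ) →
          ∑ xs (λ x → Σℤ.sum λ i → g x i ℤ.* h i) ≡ Σℤ.sum λ i → ∑ xs (λ x → g x i) ℤ.* h i
∑-*-sum {k = k} []       g h = sym (Pickℤ.sum-zero (λ i → 0ℤ ℤ.* h i) λ i → ℤ.*-zeroˡ (h i))
∑-*-sum (x ∷ xs) g h = begin
  Σℤ.sum (λ i → g x i ℤ.* h i) ℤ.+ ∑ xs (λ x → Σℤ.sum λ i → g x i ℤ.* h i)
    ≡⟨ cong (ℤ._+_ (Σℤ.sum λ i → g x i ℤ.* h i)) (∑-*-sum xs g h) ⟩
  Σℤ.sum (λ i → g x i ℤ.* h i) ℤ.+ Σℤ.sum (λ i → ∑ xs (λ x → g x i) ℤ.* h i)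
    ≡⟨ Σℤ.∑-distrib-+ (λ i → g x i ℤ.* h i) (λ i → ∑ xs (λ x → g x i) ℤ.* h i) ⟨
  Σℤ.sum (λ i → g x i ℤ.* h i ℤ.+ ∑ xs (λ x → g x i) ℤ.* h i)
    ≡⟨ Σℤ.sum-cong-≗ (λ i → ℤ.*-distribʳ-+ (h i) (g x i) (∑ xs λ x → g x i)) ⟨
  Σℤ.sum (λ i → (g x i ℤ.+ ∑ xs (λ x → g x i)) ℤ.* h i) ∎
  where open ≡-Reasoning

-- Summation over the levels is moved outside by `∑-*-sum`, first past `y` and then past `x`; at
-- each level the double sum factors into a square.
∑∑-*-sum : ∀ {k} (xs : List A) (g : A → Fin k → ℤ) →
           ∑ xs (λ x → ∑ xs λ y → Σℤ.sum λ i → g x i ℤ.* g y i) ≡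
           Σℤ.sum λ i → ∑ xs (λ x → g x i) ℤ.* ∑ xs (λ x → g x i)
∑∑-*-sum xs g = trans (∑-cong xs λ x → begin
    ∑ xs (λ y → Σℤ.sum λ i → g x i ℤ.* g y i) ≡⟨ ∑-cong xs (λ y → Σℤ.sum-cong-≗ λ i → ℤ.*-comm (g x i) (g y i)) ⟩
    ∑ xs (λ y → Σℤ.sum λ i → g y i ℤ.* g x i) ≡⟨ ∑-*-sum xs g (g x) ⟩
    Σℤ.sum (λ i → ∑ xs (λ y → g y i) ℤ.* g x i) ≡⟨ Σℤ.sum-cong-≗ (λ i → ℤ.*-comm (∑ xs λ y → g y i) (g x i)) ⟩
    Σℤ.sum (λ i → g x i ℤ.* ∑ xs (λ y → g y i)) ∎)
  (∑-*-sum xs g λ i → ∑ xs λ y → g y i)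
  where open ≡-Reasoning

∑-nonneg : ∀ (xs : List A) {f} → (∀ x → 0ℤ ℤ.≤ f x) → 0ℤ ℤ.≤ ∑ xs f
∑-nonneg []       h = ℤ.≤-refl
∑-nonneg (x ∷ xs) h = ℤ.+-mono-≤ (h x) (∑-nonneg xs h)

∑-pos : ∀ {xs : List A} {f x} → (∀ x → 0ℤ ℤ.≤ f x) → x ∈ xs → 0ℤ ℤ.< f x → 0ℤ ℤ.< ∑ xs f
∑-pos {xs = _ ∷ xs} h (here refl) p = ℤ.+-mono-<-≤ p (∑-nonneg xs h)
∑-pos {xs = x ∷ _}  h (there x∈)  p = ℤ.+-mono-≤-< (h x) (∑-pos h x∈ p)

sum-nonneg : ∀ {k} {f : Fin k → ℤ} → (∀ i → 0ℤ ℤ.≤ f i) → 0ℤ ℤ.≤ Σℤ.sum f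
sum-nonneg {zero}  h = ℤ.≤-refl
sum-nonneg {suc k} h = ℤ.+-mono-≤ (h zero) (sum-nonneg (h ∘ suc))

sum-pos : ∀ {k} {f : Fin k → ℤ} → (∀ i → 0ℤ ℤ.≤ f i) → ∀ i → 0ℤ ℤ.< f i → 0ℤ ℤ.< Σℤ.sum f
sum-pos h zero    p = ℤ.+-mono-<-≤ p (sum-nonneg (h ∘ suc))
sum-pos h (suc i) p = ℤ.+-mono-≤-< (h zero) (sum-pos (h ∘ suc) i p)

0≤i*i : ∀ i → 0ℤ ℤ.≤ i ℤ.* i
0≤i*i (ℤ.+ zero)      = ℤ.+≤+ z≤n
0≤i*i (ℤ.+ suc k)     = ℤ.+≤+ z≤n
0≤i*i (ℤ.-[1+ k ])    = ℤ.+≤+ z≤n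

signedCount : {P : A → Set} → Decidable P → (A → Parity) → List A → ℤ
signedCount P? s xs = ∑ xs λ x → if does (P? x) then sign (s x) else 0ℤ

module _ {P : A → Set} (P? : Decidable P) (s : A → Parity) where

  count : Parity → List A → ℕ
  count p xs = length (filter (λ x → P? x ×-dec (s x ℙ.≟ p)) xs)

  -- Each odd element raises the odd count by one and lowers the signed count by one; each even
  -- element raises both sides by one.
  signedCount-counts : ∀ xs → ℤ.+ count 0ℙ xs ≡ ℤ.+ count 1ℙ xs ℤ.+ signedCount P? s xs
  signedCount-counts []       = refl
  signedCount-counts (x ∷ xs) with does (P? x) | s x
  ... | false | _  = trans (signedCount-counts xs) (cong (ℤ._+_ (ℤ.+ count 1ℙ xs)) (sym (ℤ.+-identityˡ (signedCount P? s xs))))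
  ... | true  | 0ℙ = trans (cong (ℤ._+_ 1ℤ) (signedCount-counts xs)) (exchange 1ℤ (ℤ.+ count 1ℙ xs) (signedCount P? s xs))
    where
    exchange : ∀ i j k → i ℤ.+ (j ℤ.+ k) ≡ j ℤ.+ (i ℤ.+ k)
    exchange i j k = trans (sym (ℤ.+-assoc i j k)) (trans (cong (ℤ._+ k) (ℤ.+-comm i j)) (ℤ.+-assoc j i k))
  ... | true  | 1ℙ = trans (signedCount-counts xs) (cancel (ℤ.+ count 1ℙ xs) (signedCount P? s xs))
    where
    cancel : ∀ j k → j ℤ.+ k ≡ (1ℤ ℤ.+ j) ℤ.+ (-1ℤ ℤ.+ k)
    cancel j k = trans (cong (ℤ._+_ j) (trans (sym (ℤ.+-identityˡ k)) (ℤ.+-assoc 1ℤ -1ℤ k)))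
      (trans (sym (ℤ.+-assoc j 1ℤ _)) (cong (ℤ._+ (-1ℤ ℤ.+ k)) (ℤ.+-comm j 1ℤ)))

  count-< : ∀ xs → 0ℤ ℤ.< signedCount P? s xs → count 1ℙ xs < count 0ℙ xs
  count-< xs pos = ℤ.drop‿+<+ (subst₂ ℤ._<_ (ℤ.+-identityʳ _) (sym (signedCount-counts xs))
    (ℤ.+-monoʳ-< (ℤ.+ count 1ℙ xs) pos))

module _ {k} {P : A → Set} (P? : Decidable P) (s : A → Parity) (t : A → Fin k) where

  pairParity : A × A → Parity
  pairParity (x , y) = s x ℙ.+ s y

  private
    -- An element becomes a vector supported at its level `t x`. The dot product of two such vectors
    -- is the product of the signs if the levels match and 0 otherwise.
    level : A → Fin k → ℤ
    level x i = if does (P? x) then Pickℤ.pick (t x) (sign (s x)) i else 0ℤ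

  Matched : A × A → Set
  Matched (x , y) = P x × P y × t x ≡ t y

  matched? : Decidable Matched
  matched? (x , y) = P? x ×-dec P? y ×-dec (t x Fin.≟ t y)

  signedCount-matched : ∀ xs →
    signedCount matched? pairParity (cartesianProduct xs xs) ≡
    Σℤ.sum λ i → ∑ xs (λ x → level x i) ℤ.* ∑ xs (λ x → level x i)
  signedCount-matched xs =
    trans (∑-cartesianProduct xs xs λ p → if does (matched? p) then sign (pairParity p) else 0ℤ) (trans (∑-cong xs λ x → ∑-cong xs λ y → weight x y) (∑∑-*-sum xs level))
    where
    zeros : (f : Fin k → ℤ) → (∀ i → f i ≡ 0ℤ) → 0ℤ ≡ Σℤ.sum f
    zeros f h = sym (Pickℤ.sum-zero f h)
    weight : ∀ x y → (if does (matched? (x , y)) then sign (s x ℙ.+ s y) else 0ℤ) ≡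
                     Σℤ.sum λ i → level x i ℤ.* level y i
    weight x y with does (P? x)
    ... | false = zeros (λ i → 0ℤ ℤ.* level y i) λ i → ℤ.*-zeroˡ (level y i)
    ... | true with does (P? y)
    ...   | false = zeros (λ i → Pickℤ.pick (t x) (sign (s x)) i ℤ.* 0ℤ) λ i → ℤ.*-zeroʳ (Pickℤ.pick (t x) (sign (s x)) i)
    ...   | true with t x Fin.≟ t y
    ...     | no tx≢ty = zeros (λ i → Pickℤ.pick (t x) (sign (s x)) i ℤ.* Pickℤ.pick (t y) (sign (s y)) i) disjoint
      where
      disjoint : ∀ i → Pickℤ.pick (t x) (sign (s x)) i ℤ.* Pickℤ.pick (t y) (sign (s y)) i ≡ 0ℤ
      disjoint i with i Fin.≟ t x | i Fin.≟ t y
      ... | yes i≡tx | yes i≡ty = contradiction (trans (sym i≡tx) i≡ty) tx≢ty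
      ... | yes _    | no _     = ℤ.*-zeroʳ (sign (s x))
      ... | no _     | _        = ℤ.*-zeroˡ (Pickℤ.pick (t y) (sign (s y)) i)
    ...     | yes tx≡ty = trans (sym (Pickℤ.sum-pick (t y) (sign (s x ℙ.+ s y)))) (Σℤ.sum-cong-≗ combine)
      where
      combine : ∀ i → Pickℤ.pick (t y) (sign (s x ℙ.+ s y)) i ≡ Pickℤ.pick (t x) (sign (s x)) i ℤ.* Pickℤ.pick (t y) (sign (s y)) i
      combine i rewrite tx≡ty with does (i Fin.≟ t y)
      ... | true  = sign-+ (s x) (s y)
      ... | false = refl

  -- The difference is Σᵢ cᵢ², where cᵢ is the signed count of the elements with t x ≡ i.
  matched-imbalance : ∀ {xs x₀} → x₀ ∈ xs → P x₀ → (∀ x → P x → t x ≡ t x₀ → s x ≡ 0ℙ) →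
    count matched? pairParity 1ℙ (cartesianProduct xs xs) <
    count matched? pairParity 0ℙ (cartesianProduct xs xs)
  matched-imbalance {xs} {x₀} x₀∈xs Px₀ even = count-< matched? pairParity (cartesianProduct xs xs)
    (subst (0ℤ ℤ.<_) (sym (signedCount-matched xs))
      -- At level `t x₀` nothing cancels: by `even` all terms there are 0 or 1, and `x₀` contributes
      -- 1.
      (sum-pos (λ i → 0≤i*i (∑ xs λ x → level x i)) (t x₀) (square-pos (∑-pos nonneg x₀∈xs pos))))
    where
    square-pos : ∀ {i} → 0ℤ ℤ.< i → 0ℤ ℤ.< i ℤ.* i
    square-pos {ℤ.+ zero}  (ℤ.+<+ ())
    square-pos {ℤ.+ suc _} _ = ℤ.+<+ z<s
    nonneg : ∀ x → 0ℤ ℤ.≤ level x (t x₀)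
    nonneg x with P? x
    ... | no _ = ℤ.≤-refl
    ... | yes Px with t x₀ Fin.≟ t x
    ...   | no _ = ℤ.≤-refl
    ...   | yes e rewrite even x Px (sym e) = ℤ.+≤+ z≤n
    pos : 0ℤ ℤ.< level x₀ (t x₀)
    pos with P? x₀
    ... | no ¬Px₀ = contradiction Px₀ ¬Px₀
    ... | yes _ with t x₀ Fin.≟ t x₀
    ...   | no ¬e = contradiction refl ¬e
    ...   | yes _ rewrite even x₀ Px₀ refl = ℤ.+<+ z<s

-- Digraphs glued from two blocks

sum-splitAt : ∀ a {b} (h : Fin a ⊎ Fin b → ℕ) →
              Σℕ.sum (h ∘ splitAt a) ≡ Σℕ.sum (h ∘ inj₁) + Σℕ.sum (h ∘ inj₂)
sum-splitAt zero    h = refl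
sum-splitAt (suc a) h = trans
  (cong (h (inj₁ zero) +_) (trans (Σℕ.sum-cong-≗ shift) (sum-splitAt a (h ∘ [ inj₁ ∘ suc , inj₂ ]′))))
  (sym (ℕ.+-assoc (h (inj₁ zero)) _ _))
  where
  shift : ∀ i → h (splitAt (suc a) (suc i)) ≡ h ([ inj₁ ∘ suc , inj₂ ]′ (splitAt a i))
  shift i with splitAt a i
  ... | inj₁ _ = refl
  ... | inj₂ _ = refl

-- Composing `e` with `join` gives a bijection between `Fin` types, along which the sum is permuted
-- before it is split.
sum-⊎ : ∀ {k a b} (e : Fin k ↔ (Fin a ⊎ Fin b)) (h : Fin a ⊎ Fin b → ℕ) →
        Σℕ.sum (h ∘ to e) ≡ Σℕ.sum (h ∘ inj₁) + Σℕ.sum (h ∘ inj₂)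
sum-⊎ {a = a} {b} e h = begin
  Σℕ.sum (h ∘ to e)                             ≡⟨ Σℕ.sum-cong-≗ (λ x → cong h (Fin.splitAt-join a b (to e x))) ⟨
  Σℕ.sum (λ x → h (splitAt a (join a b (to e x)))) ≡⟨ Σℕ.sum-permute (h ∘ splitAt a) (↔-sym Fin.+↔⊎ ↔-∘ e) ⟨
  Σℕ.sum (h ∘ splitAt a)                        ≡⟨ sum-splitAt a h ⟩
  Σℕ.sum (h ∘ inj₁) + Σℕ.sum (h ∘ inj₂)         ∎
  where open ≡-Reasoning

size-outdegrees : ∀ {n} (F : Digraph n) → size F ≡ Σℕ.sum (outdegree F)
size-outdegrees F = sum-map _ F

sum-outdegree≡sum-indegree : ∀ {n} (F : Digraph n) → Σℕ.sum (outdegree F) ≡ Σℕ.sum (indegree F)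
sum-outdegree≡sum-indegree {n} F = begin
  Σℕ.sum (outdegree F)                              ≡⟨ Σℕ.sum-cong-≗ (outdegree-sum F) ⟩
  Σℕ.sum (λ x → Σℕ.sum λ y → bit (arc F x y))       ≡⟨ Σℕ.∑-comm (λ x y → bit (arc F x y)) ⟩
  Σℕ.sum (λ y → Σℕ.sum λ x → bit (arc F x y))       ≡⟨ Σℕ.sum-cong-≗ (indegree-sum F) ⟨
  Σℕ.sum (indegree F)                               ∎
  where open ≡-Reasoning

-- Outdegrees and indegrees have the same total, so balance at all other vertices forces it at
-- `zero`.
balanced-suc : ∀ {n} (F : Digraph (suc n)) → (∀ i → outdegree F (suc i) ≡ indegree F (suc i)) → Balanced F
balanced-suc F h (suc i) = h i
balanced-suc F h zero = ℕ.+-cancelʳ-≡ (Σℕ.sum (outdegree F ∘ suc)) _ _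
  (trans (sum-outdegree≡sum-indegree F) (cong (indegree F zero +_) (sym (Σℕ.sum-cong-≗ h))))

sum≡0 : ∀ {k} (f : Fin k → ℕ) → Σℕ.sum f ≡ 0 → ∀ i → f i ≡ 0
sum≡0 f eq zero    = ℕ.m+n≡0⇒m≡0 (f zero) eq
sum≡0 f eq (suc i) = sum≡0 (f ∘ suc) (ℕ.m+n≡0⇒n≡0 (f zero) eq) i

outdegree≡0 : ∀ {n} (F : Digraph n) {x} → outdegree F x ≡ 0 → ∀ y → arc F x y ≡ false
outdegree≡0 F {x} eq y with arc F x y | sum≡0 (λ y → bit (arc F x y)) (trans (sym (outdegree-sum F x)) eq) y
... | false | _ = refl

outdegree<n : ∀ {n} (F : Digraph n) {x} y → arc F x y ≡ false → outdegree F x < n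
outdegree<n {n} F {x} y eq = subst (outdegree F x <_) (Subset.∣⊤∣≡n n)
  (Subset.p⊂q⇒∣p∣<∣q∣ {p = lookup F x} {q = Subset.⊤} (Subset.⊆⊤ , y , Subset.∈⊤ , λ y∈ → contradiction (trans (sym ([]=⇒lookup y∈)) eq) λ ()))

-- Up to the permutations `row` and `col`, the adjacency matrix of `glue φ ψ` is block diagonal.
module Glue {k a b} (row col : Fin k ↔ (Fin a ⊎ Fin b)) where

  block : (Fin a → Fin a → Bool) → (Fin b → Fin b → Bool) → Fin a ⊎ Fin b → Fin a ⊎ Fin b → Bool
  block f g (inj₁ p) (inj₁ r) = f p r
  block f g (inj₁ _) (inj₂ _) = false
  block f g (inj₂ _) (inj₁ _) = false
  block f g (inj₂ p) (inj₂ r) = g p r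

  glue : Digraph a → Digraph b → Digraph k
  glue φ ψ = fromArcs λ x y → block (arc φ) (arc ψ) (to row x) (to col y)

  arc-glue : ∀ φ ψ x y → arc (glue φ ψ) x y ≡ block (arc φ) (arc ψ) (to row x) (to col y)
  arc-glue φ ψ = arc-fromArcs _

  arc-glue-from : ∀ φ ψ p r → arc (glue φ ψ) (from row p) (from col r) ≡ block (arc φ) (arc ψ) p r
  arc-glue-from φ ψ p r = trans (arc-glue φ ψ (from row p) (from col r))
    (cong₂ (block (arc φ) (arc ψ)) (strictlyInverseˡ row p) (strictlyInverseˡ col r))

  left : Digraph k → Digraph a
  left F = fromArcs λ p r → arc F (from row (inj₁ p)) (from col (inj₁ r))

  right : Digraph k → Digraph b
  right F = fromArcs λ p r → arc F (from row (inj₂ p)) (from col (inj₂ r))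

  left-glue : ∀ φ ψ → left (glue φ ψ) ≡ φ
  left-glue φ ψ = arc-ext λ p r → trans (arc-fromArcs _ p r) (arc-glue-from φ ψ (inj₁ p) (inj₁ r))

  right-glue : ∀ φ ψ → right (glue φ ψ) ≡ ψ
  right-glue φ ψ = arc-ext λ p r → trans (arc-fromArcs _ p r) (arc-glue-from φ ψ (inj₂ p) (inj₂ r))

  outdegree-glue : ∀ φ ψ x → outdegree (glue φ ψ) x ≡ [ outdegree φ , outdegree ψ ]′ (to row x)
  outdegree-glue φ ψ x = trans (outdegree-sum (glue φ ψ) x)
    (trans (Σℕ.sum-cong-≗ λ y → cong bit (arc-glue φ ψ x y))
      (trans (sum-⊎ col λ r → bit (block (arc φ) (arc ψ) (to row x) r)) (blocks (to row x))))
    where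
    blocks : ∀ p → Σℕ.sum (λ r → bit (block (arc φ) (arc ψ) p (inj₁ r))) +
                   Σℕ.sum (λ r → bit (block (arc φ) (arc ψ) p (inj₂ r))) ≡ [ outdegree φ , outdegree ψ ]′ p
    blocks (inj₁ p) = trans (cong₂ _+_ (sym (outdegree-sum φ p)) (Σℕ.sum-replicate-zero b)) (ℕ.+-identityʳ _)
    blocks (inj₂ p) = cong₂ _+_ (Σℕ.sum-replicate-zero a) (sym (outdegree-sum ψ p))

  indegree-glue : ∀ φ ψ y → indegree (glue φ ψ) y ≡ [ indegree φ , indegree ψ ]′ (to col y)
  indegree-glue φ ψ y = trans (indegree-sum (glue φ ψ) y)
    (trans (Σℕ.sum-cong-≗ λ x → cong bit (arc-glue φ ψ x y))
      (trans (sum-⊎ row λ p → bit (block (arc φ) (arc ψ) p (to col y))) (blocks (to col y))))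
    where
    blocks : ∀ r → Σℕ.sum (λ p → bit (block (arc φ) (arc ψ) (inj₁ p) r)) +
                   Σℕ.sum (λ p → bit (block (arc φ) (arc ψ) (inj₂ p) r)) ≡ [ indegree φ , indegree ψ ]′ r
    blocks (inj₁ r) = trans (cong₂ _+_ (sym (indegree-sum φ r)) (Σℕ.sum-replicate-zero b)) (ℕ.+-identityʳ _)
    blocks (inj₂ r) = cong₂ _+_ (Σℕ.sum-replicate-zero a) (sym (indegree-sum ψ r))

  size-glue : ∀ φ ψ → size (glue φ ψ) ≡ size φ + size ψ
  size-glue φ ψ = begin
    size (glue φ ψ)                                      ≡⟨ size-outdegrees (glue φ ψ) ⟩
    Σℕ.sum (outdegree (glue φ ψ))                        ≡⟨ Σℕ.sum-cong-≗ (outdegree-glue φ ψ) ⟩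
    Σℕ.sum ([ outdegree φ , outdegree ψ ]′ ∘ to row)     ≡⟨ sum-⊎ row [ outdegree φ , outdegree ψ ]′ ⟩
    Σℕ.sum (outdegree φ) + Σℕ.sum (outdegree ψ)          ≡⟨ cong₂ _+_ (size-outdegrees φ) (size-outdegrees ψ) ⟨
    size φ + size ψ                                      ∎
    where open ≡-Reasoning

  module _ (D : Digraph a) (E : Digraph b) where

    glue-⊑ : ∀ φ ψ → φ ⊑ D → ψ ⊑ E → glue φ ψ ⊑ glue D E
    glue-⊑ φ ψ φ⊑D ψ⊑E = arc-⊑ (glue φ ψ) (glue D E) λ x y e →
      trans (arc-glue D E x y) (blocks (to row x) (to col y) (trans (sym (arc-glue φ ψ x y)) e))
      where
      blocks : ∀ p r → block (arc φ) (arc ψ) p r ≡ true → block (arc D) (arc E) p r ≡ true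
      blocks (inj₁ p) (inj₁ r) = ⊑-arc φ D φ⊑D p r
      blocks (inj₂ p) (inj₂ r) = ⊑-arc ψ E ψ⊑E p r

    module _ (F : Digraph k) (F⊑ : F ⊑ glue D E) where

      left-⊑ : left F ⊑ D
      left-⊑ = arc-⊑ (left F) D λ p r e → trans (sym (arc-glue-from D E (inj₁ p) (inj₁ r)))
        (⊑-arc F (glue D E) F⊑ _ _ (trans (sym (arc-fromArcs _ p r)) e))

      right-⊑ : right F ⊑ E
      right-⊑ = arc-⊑ (right F) E λ p r e → trans (sym (arc-glue-from D E (inj₂ p) (inj₂ r)))
        (⊑-arc F (glue D E) F⊑ _ _ (trans (sym (arc-fromArcs _ p r)) e))

      -- Outside the two blocks `F` has no arcs, being contained in a glued digraph.
      glue-left-right : glue (left F) (right F) ≡ F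
      glue-left-right = arc-ext λ x y → trans (arc-glue (left F) (right F) x y)
        (trans (blocks (to row x) (to col y))
          (cong₂ (arc F) (strictlyInverseʳ row x) (strictlyInverseʳ col y)))
        where
        off-block : ∀ p r → block (arc D) (arc E) p r ≡ false → false ≡ arc F (from row p) (from col r)
        off-block p r eq with arc F (from row p) (from col r) in e
        ... | false = refl
        ... | true  = trans (sym eq) (trans (sym (arc-glue-from D E p r)) (⊑-arc F (glue D E) F⊑ _ _ e))
        blocks : ∀ p r → block (arc (left F)) (arc (right F)) p r ≡ arc F (from row p) (from col r)
        blocks (inj₁ p) (inj₁ r) = arc-fromArcs _ p r
        blocks (inj₁ p) (inj₂ r) = off-block (inj₁ p) (inj₂ r) refl
        blocks (inj₂ p) (inj₁ r) = off-block (inj₂ p) (inj₁ r) refl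
        blocks (inj₂ p) (inj₂ r) = arc-fromArcs _ p r

-- The graph and its cyclic orientation.

witness : ∀ {P : Set} (P? : Dec P) → does P? ≡ true → P
witness (yes p) _ = p

-- Serves both sides of the join: `u` and `v` form two cliques of one vertex each.
SameClique : ∀ {A B : Set} → A ⊎ B → A ⊎ B → Set
SameClique (inj₁ i) (inj₁ j) = i ≢ j
SameClique (inj₁ _) (inj₂ _) = ⊥
SameClique (inj₂ _) (inj₁ _) = ⊥
SameClique (inj₂ i) (inj₂ j) = i ≢ j

module _ (m : ℕ) where

  𝔾 : Graph ((m + m) + (1 + 1))
  𝔾 = (K m ∪ᴳ K m) ⋈ (K 1 ∪ᴳ K 1)

  open Graph 𝔾 using (_~_)

  Vertex : Set
  Vertex = (Fin m ⊎ Fin m) ⊎ (Fin 1 ⊎ Fin 1)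

  pattern x′ i = inj₁ (inj₁ i)
  pattern y′ i = inj₁ (inj₂ i)
  pattern u′ = inj₂ (inj₁ zero)
  pattern v′ = inj₂ (inj₂ zero)

  vertex : Fin ((m + m) + (1 + 1)) ↔ Vertex
  vertex = (Fin.+↔⊎ ⊎-↔ Fin.+↔⊎) ↔-∘ Fin.+↔⊎

  Adjacent : Vertex → Vertex → Set
  Adjacent (inj₁ p) (inj₁ r) = SameClique p r
  Adjacent (inj₁ _) (inj₂ _) = ⊤
  Adjacent (inj₂ _) (inj₁ _) = ⊤
  Adjacent (inj₂ p) (inj₂ r) = SameClique p r

  ~-Adjacent : ∀ x y → (x ~ y) ≡ Adjacent (to vertex x) (to vertex y)
  ~-Adjacent x y with splitAt (m + m) x | splitAt (m + m) y
  ... | inj₁ _ | inj₂ _ = refl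
  ... | inj₂ _ | inj₁ _ = refl
  ... | inj₁ i | inj₁ j with splitAt m i | splitAt m j
  ...   | inj₁ _ | inj₁ _ = refl
  ...   | inj₁ _ | inj₂ _ = refl
  ...   | inj₂ _ | inj₁ _ = refl
  ...   | inj₂ _ | inj₂ _ = refl
  ~-Adjacent x y | inj₂ i | inj₂ j with splitAt 1 i | splitAt 1 j
  ...   | inj₁ _ | inj₁ _ = refl
  ...   | inj₁ _ | inj₂ _ = refl
  ...   | inj₂ _ | inj₁ _ = refl
  ...   | inj₂ _ | inj₂ _ = refl

  clique : Fin (suc m) → Vertex
  clique zero    = u′
  clique (suc i) = x′ i

  clique-adjacent : ∀ {i j} → i ≢ j → Adjacent (clique i) (clique j)
  clique-adjacent {zero}  {zero}  i≢j = λ _ → i≢j refl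
  clique-adjacent {zero}  {suc j} _   = tt
  clique-adjacent {suc i} {zero}  _   = tt
  clique-adjacent {suc i} {suc j} i≢j = i≢j ∘ cong suc

  lower-bound : ∀ {j} → AlonTarsi 𝔾 j → suc m ≤ j
  lower-bound = clique≤AlonTarsi 𝔾 (from vertex ∘ clique) λ {i} {j} i≢j →
    subst id (sym (~-Adjacent (from vertex (clique i)) (from vertex (clique j))))
      (subst₂ Adjacent (sym (strictlyInverseˡ vertex (clique i))) (sym (strictlyInverseˡ vertex (clique j)))
        (clique-adjacent i≢j))

  -- The vertex 0 stands for the entry v (as a source) and the exit u (as a target) of Q₁;
  -- u and v exchange roles for Q₂.
  isArc : Fin (suc m) → Fin (suc m) → Bool
  isArc zero    zero    = false
  isArc (suc _) zero    = true
  isArc p       (suc r) = does (p Fin.<? suc r)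

  isArc-loopless : ∀ p → isArc p p ≡ false
  isArc-loopless zero    = refl
  isArc-loopless (suc i) = dec-false (suc i Fin.<? suc i) (ℕ.n≮n (suc (toℕ i)))

  isArc-< : ∀ p r → isArc p (suc r) ≡ true → p Fin.< suc r
  isArc-< zero    r _ = s≤s z≤n
  isArc-< (suc p) r e = witness (suc p Fin.<? suc r) e

  <-isArc : ∀ i j → i Fin.< j → isArc (suc i) (suc j) ≡ true
  <-isArc i j i<j = dec-true (suc i Fin.<? suc j) (s≤s i<j)

  half : Digraph (suc m)
  half = fromArcs isArc

  -- The bijections differ only at `u` and `v`: as a source `v` belongs to the first block, as a
  -- target to the second, and `u` conversely. This twist makes the cyclic orientation block
  -- diagonal with two copies of `half`.
  rowOf colOf : Vertex ↔ (Fin (suc m) ⊎ Fin (suc m))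
  rowOf = mk↔ₛ′
    (λ { (x′ i) → inj₁ (suc i) ; (y′ i) → inj₂ (suc i) ; v′ → inj₁ zero ; u′ → inj₂ zero })
    (λ { (inj₁ zero) → v′ ; (inj₁ (suc i)) → x′ i ; (inj₂ zero) → u′ ; (inj₂ (suc i)) → y′ i })
    (λ { (inj₁ zero) → refl ; (inj₁ (suc i)) → refl ; (inj₂ zero) → refl ; (inj₂ (suc i)) → refl })
    (λ { (x′ i) → refl ; (y′ i) → refl ; v′ → refl ; u′ → refl })
  colOf = mk↔ₛ′
    (λ { (x′ i) → inj₁ (suc i) ; (y′ i) → inj₂ (suc i) ; u′ → inj₁ zero ; v′ → inj₂ zero })
    (λ { (inj₁ zero) → u′ ; (inj₁ (suc i)) → x′ i ; (inj₂ zero) → v′ ; (inj₂ (suc i)) → y′ i })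
    (λ { (inj₁ zero) → refl ; (inj₁ (suc i)) → refl ; (inj₂ zero) → refl ; (inj₂ (suc i)) → refl })
    (λ { (x′ i) → refl ; (y′ i) → refl ; v′ → refl ; u′ → refl })

  open Glue (rowOf ↔-∘ vertex) (colOf ↔-∘ vertex)

  𝔻 : Digraph ((m + m) + (1 + 1))
  𝔻 = glue half half

  isArcᵛ : Vertex → Vertex → Bool
  isArcᵛ x y = block isArc isArc (to rowOf x) (to colOf y)

  arc-𝔻 : ∀ x y → arc 𝔻 x y ≡ isArcᵛ (to vertex x) (to vertex y)
  arc-𝔻 x y = trans (arc-glue half half x y) (blocks (to rowOf (to vertex x)) (to colOf (to vertex y)))
    where
    blocks : ∀ p r → block (arc half) (arc half) p r ≡ block isArc isArc p r
    blocks (inj₁ p) (inj₁ r) = arc-fromArcs isArc p r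
    blocks (inj₁ _) (inj₂ _) = refl
    blocks (inj₂ _) (inj₁ _) = refl
    blocks (inj₂ p) (inj₂ r) = arc-fromArcs isArc p r

  isArc-≢ : ∀ i j → isArc (suc i) (suc j) ≡ true → i ≢ j
  isArc-≢ i .i e refl = ℕ.<-irrefl refl (isArc-< (suc i) i e)

  isArc-antisym : ∀ i j → isArc (suc i) (suc j) ≡ true → isArc (suc j) (suc i) ≡ true → ⊥
  isArc-antisym i j e f = ℕ.<-asym (isArc-< (suc i) j e) (isArc-< (suc j) i f)

  isArc-complete : ∀ i j → i ≢ j → isArc (suc i) (suc j) ≡ true ⊎ isArc (suc j) (suc i) ≡ true
  isArc-complete i j i≢j with ℕ.<-cmp (toℕ i) (toℕ j)
  ... | tri< i<j _ _ = inj₁ (<-isArc i j i<j)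
  ... | tri≈ _ i≡j _ = contradiction (Fin.toℕ-injective i≡j) i≢j
  ... | tri> _ _ j<i = inj₂ (<-isArc j i j<i)

  isArcᵛ-sound : ∀ x y → isArcᵛ x y ≡ true → Adjacent x y
  isArcᵛ-sound (x′ i) (x′ j) e = isArc-≢ i j e
  isArcᵛ-sound (y′ i) (y′ j) e = isArc-≢ i j e
  isArcᵛ-sound (x′ _) (y′ _) ()
  isArcᵛ-sound (y′ _) (x′ _) ()
  isArcᵛ-sound (inj₁ _) (inj₂ _) _ = tt
  isArcᵛ-sound (inj₂ _) (inj₁ _) _ = tt
  isArcᵛ-sound u′ u′ ()
  isArcᵛ-sound u′ v′ ()
  isArcᵛ-sound v′ u′ ()
  isArcᵛ-sound v′ v′ ()

  isArcᵛ-complete : ∀ x y → Adjacent x y → isArcᵛ x y ≡ true ⊎ isArcᵛ y x ≡ true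
  isArcᵛ-complete (x′ i) (x′ j) i≢j = isArc-complete i j i≢j
  isArcᵛ-complete (y′ i) (y′ j) i≢j = isArc-complete i j i≢j
  isArcᵛ-complete (x′ _) u′ _ = inj₁ refl
  isArcᵛ-complete (x′ _) v′ _ = inj₂ refl
  isArcᵛ-complete (y′ _) u′ _ = inj₂ refl
  isArcᵛ-complete (y′ _) v′ _ = inj₁ refl
  isArcᵛ-complete u′ (x′ _) _ = inj₂ refl
  isArcᵛ-complete v′ (x′ _) _ = inj₁ refl
  isArcᵛ-complete u′ (y′ _) _ = inj₁ refl
  isArcᵛ-complete v′ (y′ _) _ = inj₂ refl
  isArcᵛ-complete u′ u′ z≢z = contradiction refl z≢z
  isArcᵛ-complete v′ v′ z≢z = contradiction refl z≢z

  isArcᵛ-antisym : ∀ x y → isArcᵛ x y ≡ true → isArcᵛ y x ≡ true → ⊥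
  isArcᵛ-antisym (x′ i) (x′ j) = isArc-antisym i j
  isArcᵛ-antisym (y′ i) (y′ j) = isArc-antisym i j
  isArcᵛ-antisym (x′ _) (y′ _) ()
  isArcᵛ-antisym (y′ _) (x′ _) ()
  isArcᵛ-antisym (x′ _) u′ _ ()
  isArcᵛ-antisym (x′ _) v′ ()
  isArcᵛ-antisym (y′ _) u′ ()
  isArcᵛ-antisym (y′ _) v′ _ ()
  isArcᵛ-antisym u′ (x′ _) ()
  isArcᵛ-antisym v′ (x′ _) _ ()
  isArcᵛ-antisym u′ (y′ _) _ ()
  isArcᵛ-antisym v′ (y′ _) ()
  isArcᵛ-antisym u′ u′ ()
  isArcᵛ-antisym u′ v′ ()
  isArcᵛ-antisym v′ u′ ()
  isArcᵛ-antisym v′ v′ ()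

  orientation : IsOrientation 𝔾 𝔻
  orientation = record
    { sound    = λ {x} {y} xy → subst id (sym (~-Adjacent x y)) (isArcᵛ-sound (to vertex x) (to vertex y) (Arc⇒isArcᵛ x y xy))
    ; complete = λ {x} {y} x~y → [ inj₁ ∘ isArcᵛ⇒Arc x y , inj₂ ∘ isArcᵛ⇒Arc y x ]′
                   (isArcᵛ-complete (to vertex x) (to vertex y) (subst id (~-Adjacent x y) x~y))
    ; antisym  = λ {x} {y} xy yx → isArcᵛ-antisym (to vertex x) (to vertex y) (Arc⇒isArcᵛ x y xy) (Arc⇒isArcᵛ y x yx)
    }
    where
    Arc⇒isArcᵛ : ∀ x y → Arc 𝔻 x y → isArcᵛ (to vertex x) (to vertex y) ≡ true
    Arc⇒isArcᵛ x y xy = trans (sym (arc-𝔻 x y)) ([]=⇒lookup xy)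
    isArcᵛ⇒Arc : ∀ x y → isArcᵛ (to vertex x) (to vertex y) ≡ true → Arc 𝔻 x y
    isArcᵛ⇒Arc x y e = lookup⇒[]= y (lookup 𝔻 x) (trans (arc-𝔻 x y) e)

  -- A row has `suc m` entries and its diagonal entry is absent; at `zero` this is the missing arc
  -- between `u` and `v`.
  outdegree-half : ∀ p → outdegree half p < suc m
  outdegree-half p = outdegree<n half {p} p (trans (arc-fromArcs isArc p p) (isArc-loopless p))

  outdegree-𝔻 : ∀ x → outdegree 𝔻 x < suc m
  outdegree-𝔻 x = subst (_< suc m) (sym (outdegree-glue half half x)) (blocks (to rowOf (to vertex x)))
    where
    blocks : ∀ p → [ outdegree half , outdegree half ]′ p < suc m
    blocks (inj₁ p) = outdegree-half p
    blocks (inj₂ p) = outdegree-half p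

  -- Flow values and the count of Eulerian subdigraphs.

  flow : Digraph (suc m) → Fin (suc (suc m))
  -- A row of length `suc m` has from 0 to `suc m` arcs, hence `suc (suc m)` levels.
  flow φ = fromℕ< (s≤s (Subset.∣p∣≤n (lookup φ zero)))

  flow≡⇒outdegree≡ : ∀ φ ψ → flow φ ≡ flow ψ → outdegree φ zero ≡ outdegree ψ zero
  flow≡⇒outdegree≡ φ ψ = Fin.fromℕ<-injective _ _ (s≤s (Subset.∣p∣≤n (lookup φ zero))) (s≤s (Subset.∣p∣≤n (lookup ψ zero)))

  outdegree≡⇒flow≡ : ∀ φ ψ → outdegree φ zero ≡ outdegree ψ zero → flow φ ≡ flow ψ
  outdegree≡⇒flow≡ φ ψ eq = Fin.fromℕ<-cong _ _ eq _ _

  glue-eulerian : ∀ φ ψ → EulerianSubdigraph half φ → EulerianSubdigraph half ψ →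
                  outdegree φ zero ≡ outdegree ψ zero → EulerianSubdigraph 𝔻 (glue φ ψ)
  glue-eulerian φ ψ (φ⊑ , φ-bal) (ψ⊑ , ψ-bal) eq = glue-⊑ half half φ ψ φ⊑ ψ⊑ , λ x →
    trans (outdegree-glue φ ψ x) (trans (balanced (to vertex x)) (sym (indegree-glue φ ψ x)))
    where
    balanced : ∀ x → [ outdegree φ , outdegree ψ ]′ (to rowOf x) ≡ [ indegree φ , indegree ψ ]′ (to colOf x)
    balanced (x′ i) = φ-bal (suc i)
    balanced (y′ i) = ψ-bal (suc i)
    -- Arcs enter `u` from the first half and leave it into the second, so balance at `u` and at `v`
    -- needs equal flows.
    balanced u′ = trans (sym eq) (φ-bal zero)
    balanced v′ = trans eq (ψ-bal zero)

  module _ (F : Digraph ((m + m) + (1 + 1))) (eulerian : EulerianSubdigraph 𝔻 F) where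

    private
      F⊑ = proj₁ eulerian
      F≡ = glue-left-right half half F F⊑

    balanced-blocks : ∀ x → [ outdegree (left F) , outdegree (right F) ]′ (to rowOf x) ≡
                            [ indegree (left F) , indegree (right F) ]′ (to colOf x)
    balanced-blocks x = begin
      [ outdegree (left F) , outdegree (right F) ]′ (to rowOf x)
        ≡⟨ cong (λ z → [ outdegree (left F) , outdegree (right F) ]′ (to rowOf z)) (strictlyInverseˡ vertex x) ⟨
      [ outdegree (left F) , outdegree (right F) ]′ (to rowOf (to vertex (from vertex x)))
        ≡⟨ outdegree-glue (left F) (right F) (from vertex x) ⟨
      outdegree (glue (left F) (right F)) (from vertex x)
        ≡⟨ subst Balanced (sym F≡) (proj₂ eulerian) (from vertex x) ⟩
      indegree (glue (left F) (right F)) (from vertex x)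
        ≡⟨ indegree-glue (left F) (right F) (from vertex x) ⟩
      [ indegree (left F) , indegree (right F) ]′ (to colOf (to vertex (from vertex x)))
        ≡⟨ cong (λ z → [ indegree (left F) , indegree (right F) ]′ (to colOf z)) (strictlyInverseˡ vertex x) ⟩
      [ indegree (left F) , indegree (right F) ]′ (to colOf x) ∎
      where open ≡-Reasoning

    -- Balance of `F` at `u` and `v` mixes the two halves; balance of one half at `zero` comes from
    -- its clique vertices through `balanced-suc`.
    left-eulerian : EulerianSubdigraph half (left F)
    left-eulerian = left-⊑ half half F F⊑ , balanced-suc (left F) λ i → balanced-blocks (x′ i)

    right-eulerian : EulerianSubdigraph half (right F)
    right-eulerian = right-⊑ half half F F⊑ , balanced-suc (right F) λ i → balanced-blocks (y′ i)

    -- At `v`, the outdegree belongs to the left half and the indegree to the right one.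
    left-right-outdegree : outdegree (left F) zero ≡ outdegree (right F) zero
    left-right-outdegree = trans (balanced-blocks v′) (sym (proj₂ right-eulerian zero))

  -- Induction along the vertex order: arcs of `half` into `suc i` come from smaller vertices, which
  -- have no outgoing arcs in `φ`. So nothing enters `suc i`, and by balance nothing leaves it.
  acyclic : ∀ φ → EulerianSubdigraph half φ → outdegree φ zero ≡ 0 → ∀ p → outdegree φ p ≡ 0
  acyclic φ (φ⊑ , bal) out₀ = WellFounded.All.wfRec <-wellFounded Level.zero (λ p → outdegree φ p ≡ 0) step
    where
    step : ∀ p → (∀ {r} → r Fin.< p → outdegree φ r ≡ 0) → outdegree φ p ≡ 0
    step zero    _  = out₀
    step (suc i) ih = trans (bal (suc i)) (trans (indegree-sum φ (suc i))
      (trans (Σℕ.sum-cong-≗ λ r → cong bit (no-arc r)) (Σℕ.sum-replicate-zero (suc m))))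
      where
      no-arc : ∀ r → arc φ r (suc i) ≡ false
      no-arc r with arc φ r (suc i) in e
      ... | false = refl
      ... | true  = trans (sym e) (outdegree≡0 φ
        (ih (isArc-< r i (trans (sym (arc-fromArcs isArc r (suc i))) (⊑-arc φ half φ⊑ r (suc i) e)))) (suc i))

  ∅ : Digraph (suc m)
  ∅ = fromArcs λ _ _ → false

  outdegree-∅ : ∀ p → outdegree ∅ p ≡ 0
  outdegree-∅ p = trans (outdegree-sum ∅ p)
    (trans (Σℕ.sum-cong-≗ λ r → cong bit (arc-fromArcs (λ _ _ → false) p r)) (Σℕ.sum-replicate-zero (suc m)))

  indegree-∅ : ∀ p → indegree ∅ p ≡ 0
  indegree-∅ p = trans (indegree-sum ∅ p)
    (trans (Σℕ.sum-cong-≗ λ r → cong bit (arc-fromArcs (λ _ _ → false) r p)) (Σℕ.sum-replicate-zero (suc m)))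

  ∅-eulerian : EulerianSubdigraph half ∅
  ∅-eulerian = arc-⊑ ∅ half (λ p r e → contradiction (trans (sym e) (arc-fromArcs (λ _ _ → false) p r)) λ ())
             , λ p → trans (outdegree-∅ p) (sym (indegree-∅ p))

  no-flow-even : ∀ φ → EulerianSubdigraph half φ → flow φ ≡ flow ∅ → parity (size φ) ≡ 0ℙ
  no-flow-even φ eu eq = cong parity (trans (size-outdegrees φ)
    (trans (Σℕ.sum-cong-≗ (acyclic φ eu (trans (flow≡⇒outdegree≡ φ ∅ eq) (outdegree-∅ zero))))
      (Σℕ.sum-replicate-zero (suc m))))

  private
    half? = eulerianSubdigraph? half
    sizeParity : Digraph (suc m) → Parity
    sizeParity φ = parity (size φ)
    digraphs = allDigraphs (suc m)
    pairs = cartesianProduct digraphs digraphs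
    matchedCount : Parity → ℕ
    matchedCount p = count (matched? half? sizeParity flow) (pairParity half? sizeParity flow) p pairs

  parity-glue : ∀ φ ψ → parity (size (glue φ ψ)) ≡ parity (size φ) ℙ.+ parity (size ψ)
  parity-glue φ ψ = trans (cong parity (size-glue φ ψ)) (ℙ.+-homo-+ (size φ) (size ψ))

  -- Splitting into the two halves is undone by gluing; size is additive under gluing, so parities
  -- add.
  #eulerian≤pairs : ∀ p → #eulerian p 𝔻 ≤ matchedCount p
  #eulerian≤pairs p = length-filter-≤
    (λ F → eulerianSubdigraph? 𝔻 F ×-dec (parity (size F) ℙ.≟ p))
    (λ x → matched? half? sizeParity flow x ×-dec (pairParity half? sizeParity flow x ℙ.≟ p))
    (allDigraphs-unique _) (λ (φ , ψ) → ∈-cartesianProduct⁺ (∈-allDigraphs φ) (∈-allDigraphs ψ))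
    (λ F → left F , right F) (λ (φ , ψ) → glue φ ψ)
    (λ {F} (eu , e) →
      (left-eulerian F eu , right-eulerian F eu , outdegree≡⇒flow≡ (left F) (right F) (left-right-outdegree F eu)) ,
      trans (sym (parity-glue (left F) (right F)))
        (trans (cong (parity ∘ size) (glue-left-right half half F (proj₁ eu))) e))
    (λ {F} (eu , _) → glue-left-right half half F (proj₁ eu))

  pairs≤#eulerian : ∀ p → matchedCount p ≤ #eulerian p 𝔻
  pairs≤#eulerian p = length-filter-≤
    (λ x → matched? half? sizeParity flow x ×-dec (pairParity half? sizeParity flow x ℙ.≟ p))
    (λ F → eulerianSubdigraph? 𝔻 F ×-dec (parity (size F) ℙ.≟ p))
    (Unique.cartesianProduct⁺ (allDigraphs-unique (suc m)) (allDigraphs-unique (suc m))) ∈-allDigraphs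
    (λ (φ , ψ) → glue φ ψ) (λ F → left F , right F)
    (λ {(φ , ψ)} ((φ-eu , ψ-eu , eq) , e) →
      glue-eulerian φ ψ φ-eu ψ-eu (flow≡⇒outdegree≡ φ ψ eq) , trans (parity-glue φ ψ) e)
    (λ {(φ , ψ)} _ → cong₂ _,_ (left-glue φ ψ) (right-glue φ ψ))

  #odd<#even : #odd 𝔻 < #even 𝔻
  #odd<#even = ℕ.≤-<-trans (#eulerian≤pairs 1ℙ) (ℕ.<-≤-trans
    (matched-imbalance half? sizeParity flow (∈-allDigraphs ∅) ∅-eulerian no-flow-even)
    (pairs≤#eulerian 0ℙ))

  AT-𝔾 : AT 𝔾 ≈ suc m
  AT-𝔾 = record
    { holds = 𝔻 , orientation , outdegree-𝔻 , λ eq → ℕ.<⇒≢ #odd<#even (sym eq)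
    ; least = lower-bound
    }

theorem2 : ∀ (n : ℕ) → 4 ≤ n → 2 ∣ n →
    let m = (n ∸ 2) / 2 in
    AT ((K m ∪ᴳ K m) ⋈ (K 1 ∪ᴳ K 1)) ≈ (n / 2)
theorem2 .(zero * 2) () (divides zero refl)
theorem2 .(suc r * 2) _ (divides (suc r) refl) =
  -- For `n = suc r * 2`, `n ∸ 2` reduces to `r * 2`, so `m` is `r` and `n / 2` is `suc r`.
  subst₂ (λ m k → AT ((K m ∪ᴳ K m) ⋈ (K 1 ∪ᴳ K 1)) ≈ k)
    (sym (m*n/n≡m r 2)) (sym (m*n/n≡m (suc r) 2)) (AT-𝔾 r)
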